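{- Let $n\geq 2$ be an integer, let $p$ be a prime number with $\gcd(n,p)=1$, let $\alpha\geq 1$ be an integer, and let $m=np^{\alpha}$. (1) If $n$ is square-free, then for every exponential divisor $d_e$ of $m$ one has $H(d_e)\geq H(m)$. (2) If $n$ is not square-free, then for every exponential divisor $d_e$ of $m$ of the form $d_e=np^{\beta}$, one has $H(d_e)\leq H(m)$ whenever $\beta\leq\alpha\leq\Omega(n)e^{ -H(n)}$.
   Context: $\log$ is the natural logarithm. For an integer $N=p_1^{\alpha_1}\cdots p_r^{\alpha_r}\geq 2$ (distinct primes $p_i$, exponents $\alpha_i\geq 1$), $\Omega(N)=\alpha_1+\dots+\alpha_r$ and the entropy of $N$ is $$H(N)=-\sum_{i=1}^r\frac{\alpha_i}{\Omega(N)}\log\frac{\alpha_i}{\Omega(N)}.$$ An exponential divisor of $N$ is an integer $d=p_1^{\beta_1}\cdots p_r^{\beta_r}$ with all $\beta_i\geq 1$ and $\beta_i\mid\alpha_i$ for every $i\in\{1,\dots,r\}$. -}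

module Defs where

import Data.Integer.Base as ℤ
import Data.Integer.Properties as ℤ
open import Data.List.Base using (List; []; _∷_; length; filter; deduplicate; map; foldr)
open import Data.Nat.Base as ℕ using (ℕ; zero; suc)
open import Data.Nat.Divisibility using (_∣_)
open import Data.Nat.ListAction using (product)
open import Data.Nat.Primality.Factorisation using (factors; factorise)
import Data.Nat.Properties as ℕ
open import Data.List.Membership.Propositional using (_∈_)
open import Data.Product.Base using (Σ; ∃-syntax; _×_; _,_; proj₁; proj₂)
open import Data.Rational.Base
open import Data.Rational.Properties
open import Data.Rational.Solver using (module +-*-Solver)
import Data.Rational.Unnormalised.Base as ℚᵘ
import Data.Rational.Unnormalised.Properties as ℚᵘ
open import Data.Sum.Base using (inj₁; inj₂; [_,_]′)
open import Relation.Binary.PropositionalEquality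

open import Algebra.Bundles using (CommutativeRing)
open import Algebra.Properties.CommutativeSemiring.Exp
  (CommutativeRing.commutativeSemiring +-*-commutativeRing)
  using (_^_; ^-distrib-*; ^-assocʳ)

ι : ℕ → ℚ
ι n = ℤ.+ n / 1

-- inv n is 1/(n + 1).
inv : ℕ → ℚ
inv n = ℤ.+ 1 / suc n

ι-+ : ∀ m n → ι (m ℕ.+ n) ≡ ι m + ι n
ι-+ m n = toℚᵘ-injective (begin
  toℚᵘ (ι (m ℕ.+ n))                 ≈⟨ toℚᵘ-fromℚᵘ (ℚᵘ.mkℚᵘ (ℤ.+ (m ℕ.+ n)) 0) ⟩
  ℚᵘ.mkℚᵘ (ℤ.+ (m ℕ.+ n)) 0            ≈⟨ ℚᵘ.*≡* (cong (ℤ._* ℤ.+ 1) (cong₂ ℤ._+_ (sym (ℤ.*-identityʳ (ℤ.+ m))) (sym (ℤ.*-identityʳ (ℤ.+ n))))) ⟩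
  ℚᵘ.mkℚᵘ (ℤ.+ m) 0 ℚᵘ.+ ℚᵘ.mkℚᵘ (ℤ.+ n) 0 ≈⟨ ℚᵘ.+-cong (toℚᵘ-fromℚᵘ (ℚᵘ.mkℚᵘ (ℤ.+ m) 0)) (toℚᵘ-fromℚᵘ (ℚᵘ.mkℚᵘ (ℤ.+ n) 0)) ⟨
  toℚᵘ (ι m) ℚᵘ.+ toℚᵘ (ι n)         ≈⟨ toℚᵘ-homo-+ (ι m) (ι n) ⟨
  toℚᵘ (ι m + ι n)                   ∎)
  where open ℚᵘ.≃-Reasoning

ι-* : ∀ m n → ι (m ℕ.* n) ≡ ι m * ι n
ι-* zero    n = sym (*-zeroˡ (ι n))
ι-* (suc m) n = begin
  ι (n ℕ.+ m ℕ.* n)  ≡⟨ ι-+ n (m ℕ.* n) ⟩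
  ι n + ι (m ℕ.* n)  ≡⟨ cong (ι n +_) (ι-* m n) ⟩
  ι n + ι m * ι n    ≡⟨ solve 2 (λ n m → n :+ m :* n := (con 1ℚ :+ m) :* n) refl (ι n) (ι m) ⟩
  (1ℚ + ι m) * ι n   ≡⟨ cong (_* ι n) (ι-+ 1 m) ⟨
  ι (suc m) * ι n    ∎
  where open ≡-Reasoning; open +-*-Solver

ι-suc : ∀ n → ι (suc n) ≡ 1ℚ + ι n
ι-suc n = ι-+ 1 n

ι-inv : ∀ n → ι (suc n) * inv n ≡ 1ℚ
ι-inv n = toℚᵘ-injective (begin
  toℚᵘ (ι (suc n) * inv n)           ≈⟨ toℚᵘ-homo-* (ι (suc n)) (inv n) ⟩
  toℚᵘ (ι (suc n)) ℚᵘ.* toℚᵘ (inv n) ≈⟨ ℚᵘ.*-cong (toℚᵘ-fromℚᵘ (ℚᵘ.mkℚᵘ (ℤ.+ suc n) 0)) (toℚᵘ-fromℚᵘ (ℚᵘ.mkℚᵘ (ℤ.+ 1) n)) ⟩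
  ℚᵘ.mkℚᵘ (ℤ.+ suc n) 0 ℚᵘ.* ℚᵘ.mkℚᵘ (ℤ.+ 1) n ≈⟨ ℚᵘ.*≡* (trans (ℤ.*-identityʳ _) (trans (ℤ.*-identityʳ _) (cong ℤ.+_ (sym (trans (ℕ.*-identityˡ _) (ℕ.*-identityˡ _)))))) ⟩
  toℚᵘ 1ℚ ∎)
  where open ℚᵘ.≃-Reasoning

≤-by : ∀ {l r} e → l + e ≡ r → 0ℚ ≤ e → l ≤ r
≤-by {l} e refl 0≤e = subst (_≤ l + e) (+-identityʳ l) (+-monoʳ-≤ l 0≤e)

0≤- : ∀ {l r} → l ≤ r → 0ℚ ≤ r - l
0≤- {l} {r} l≤r = subst (_≤ r - l) (+-inverseʳ l) (+-monoˡ-≤ (- l) l≤r)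

0≤+ : ∀ {p q} → 0ℚ ≤ p → 0ℚ ≤ q → 0ℚ ≤ p + q
0≤+ = +-mono-≤

0≤* : ∀ {p q} → 0ℚ ≤ p → 0ℚ ≤ q → 0ℚ ≤ p * q
0≤* {p} {q} 0≤p 0≤q = nonNegative⁻¹ (p * q) {{nonNeg*nonNeg⇒nonNeg p {{nonNegative 0≤p}} q {{nonNegative 0≤q}}}}

*-monoˡ : ∀ {r p q} → 0ℚ ≤ r → p ≤ q → r * p ≤ r * q
*-monoˡ {r} 0≤r = *-monoˡ-≤-nonNeg r {{nonNegative 0≤r}}

*-monoʳ : ∀ {r p q} → 0ℚ ≤ r → p ≤ q → p * r ≤ q * r
*-monoʳ {r} 0≤r = *-monoʳ-≤-nonNeg r {{nonNegative 0≤r}}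

*-mono : ∀ {p p′ q q′} → 0ℚ ≤ p → 0ℚ ≤ q → p ≤ p′ → q ≤ q′ → p * q ≤ p′ * q′
*-mono 0≤p 0≤q p≤ q≤ = ≤-trans (*-monoˡ 0≤p q≤) (*-monoʳ (≤-trans 0≤q q≤) p≤)

0≤1 : 0ℚ ≤ 1ℚ
0≤1 = nonNegative⁻¹ 1ℚ

0≤ι : ∀ n → 0ℚ ≤ ι n
0≤ι zero    = ≤-refl
0≤ι (suc n) = subst (0ℚ ≤_) (sym (ι-suc n)) (0≤+ 0≤1 (0≤ι n))

ι-mono : ∀ {m n} → m ℕ.≤ n → ι m ≤ ι n
ι-mono {m} {n} m≤n = ≤-by (ι (n ℕ.∸ m))
  (trans (sym (ι-+ m (n ℕ.∸ m))) (cong ι (ℕ.m+[n∸m]≡n m≤n))) (0≤ι (n ℕ.∸ m))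

0<inv : ∀ n → 0ℚ < inv n
0<inv n = positive⁻¹ (inv n) {{normalize-pos 1 (suc n)}}

0≤inv : ∀ n → 0ℚ ≤ inv n
0≤inv n = <⇒≤ (0<inv n)

0<ι : ∀ n → 0ℚ < ι (suc n)
0<ι n = positive⁻¹ (ι (suc n)) {{normalize-pos (suc n) 1}}

ι*-cancel : ∀ n {p q} → ι (suc n) * p ≤ ι (suc n) * q → p ≤ q
ι*-cancel n = *-cancelˡ-≤-pos (ι (suc n)) {{positive (0<ι n)}}

inv-antimono : ∀ {m n} → m ℕ.≤ n → inv n ≤ inv m
inv-antimono {m} {n} m≤n = ι*-cancel m (ι*-cancel n (subst₂ _≤_ eq₁ eq₂ (ι-mono (ℕ.s≤s m≤n))))
  where
  open +-*-Solver
  eq₁ : ι (suc m) ≡ ι (suc n) * (ι (suc m) * inv n)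
  eq₁ = sym (trans (solve 3 (λ n m i → n :* (m :* i) := m :* (n :* i)) refl (ι (suc n)) (ι (suc m)) (inv n))
        (trans (cong (ι (suc m) *_) (ι-inv n)) (*-identityʳ _)))
  eq₂ : ι (suc n) ≡ ι (suc n) * (ι (suc m) * inv m)
  eq₂ = sym (trans (cong (ι (suc n) *_) (ι-inv m)) (*-identityʳ _))

inv≤1 : ∀ n → inv n ≤ 1ℚ
inv≤1 n = inv-antimono {0} {n} ℕ.z≤n

archimedean : ∀ q → ∃[ n ] q ≤ ι n
archimedean (mkℚ ℤ.-[1+ n ] d c) = 0 , <⇒≤ (negative⁻¹ (mkℚ ℤ.-[1+ n ] d c))
archimedean q@(mkℚ (ℤ.+ n) d c) = n , toℚᵘ-cancel-≤ (ℚᵘ.≤-respʳ-≃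
  (ℚᵘ.≃-sym (toℚᵘ-fromℚᵘ (ℚᵘ.mkℚᵘ (ℤ.+ n) 0)))
  (ℚᵘ.*≤* (subst₂ ℤ._≤_ (ℤ.pos-* n 1) (ℤ.pos-* n (suc d)) (ℤ.+≤+ (ℕ.*-monoʳ-≤ n (ℕ.s≤s ℕ.z≤n))))))

inv-small : ∀ ε → 0ℚ < ε → ∃[ N ] inv N ≤ ε
inv-small ε 0<ε = N , ι*-cancel N (begin
  ι (suc N) * inv N   ≡⟨ trans (ι-inv N) (sym (*-inverseˡ ε)) ⟩
  1/ ε * ε            ≤⟨ *-monoʳ (<⇒≤ 0<ε) 1/ε≤N ⟩
  ι N * ε             ≤⟨ *-monoʳ (<⇒≤ 0<ε) (ι-mono (ℕ.n≤1+n N)) ⟩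
  ι (suc N) * ε       ∎)
  where
  open ≤-Reasoning
  instance _ = >-nonZero 0<ε
  bound = archimedean (1/ ε)
  N = proj₁ bound
  1/ε≤N = proj₂ bound

0<* : ∀ {p q} → 0ℚ < p → 0ℚ < q → 0ℚ < p * q
0<* {p} {q} 0<p 0<q = positive⁻¹ (p * q) {{pos*pos⇒pos p {{positive 0<p}} q {{positive 0<q}}}}

half : ∀ ε → ½ * ε + ½ * ε ≡ ε
half = solve 1 (λ ε → con ½ :* ε :+ con ½ :* ε := ε) refl
  where open +-*-Solver

0<half : ∀ {ε} → 0ℚ < ε → 0ℚ < ½ * ε
0<half = 0<* (positive⁻¹ ½)

∣∣-bound : ∀ {p ε} → p ≤ ε → - p ≤ ε → ∣ p ∣ ≤ ε
∣∣-bound {p} p≤ε -p≤ε with ∣p∣≡p∨∣p∣≡-p p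
... | inj₁ eq = subst (_≤ _) (sym eq) p≤ε
... | inj₂ eq = subst (_≤ _) (sym eq) -p≤ε

p≤∣p∣ : ∀ p → p ≤ ∣ p ∣
p≤∣p∣ p with ≤-total 0ℚ p
... | inj₁ 0≤p = ≤-reflexive (sym (0≤p⇒∣p∣≡p 0≤p))
... | inj₂ p≤0 = ≤-trans p≤0 (0≤∣p∣ p)

neg-- : ∀ p q → - (p - q) ≡ q - p
neg-- = solve 2 (λ p q → :- (p :- q) := q :- p) refl
  where open +-*-Solver

IsCauchy : (ℕ → ℚ) → Set
IsCauchy s = ∀ ε → 0ℚ < ε →
  ∃[ N ] (∀ m n → N ℕ.≤ m → N ℕ.≤ n → ∣ s m - s n ∣ ≤ ε)

record ℝ : Set where
  constructor mkℝ
  field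
    seq    : ℕ → ℚ
    cauchy : IsCauchy seq

open ℝ public

-- lim x ≤ lim y.  Equality of reals is x ≤ℝ y × y ≤ℝ x, not _≡_.
infix 4 _≤ℝ_
_≤ℝ_ : ℝ → ℝ → Set
x ≤ℝ y = ∀ ε → 0ℚ < ε → ∃[ N ] (∀ n → N ℕ.≤ n → seq x n ≤ seq y n + ε)

oneSided⇒cauchy : ∀ s → (∀ ε → 0ℚ < ε →
  ∃[ N ] (∀ m n → N ℕ.≤ m → N ℕ.≤ n → s m - s n ≤ ε)) → IsCauchy s
oneSided⇒cauchy s f ε 0<ε = proj₁ (f ε 0<ε) , λ m n N≤m N≤n → ∣∣-bound (b m n N≤m N≤n)
  (subst (_≤ ε) (sym (neg-- (s m) (s n))) (b n m N≤n N≤m))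
  where b = proj₂ (f ε 0<ε)

cauchy⇒oneSided : ∀ s → IsCauchy s → ∀ ε → 0ℚ < ε →
  ∃[ N ] (∀ m n → N ℕ.≤ m → N ℕ.≤ n → s m - s n ≤ ε)
cauchy⇒oneSided s c ε 0<ε = proj₁ (c ε 0<ε) , λ m n N≤m N≤n →
  ≤-trans (p≤∣p∣ (s m - s n)) (proj₂ (c ε 0<ε) m n N≤m N≤n)

fromℚ : ℚ → ℝ
fromℚ q = mkℝ (λ _ → q) λ ε 0<ε → 0 , λ _ _ _ _ →
  subst (λ z → ∣ z ∣ ≤ ε) (sym (+-inverseʳ q)) (<⇒≤ 0<ε)

infixl 6 _+ℝ_
_+ℝ_ : ℝ → ℝ → ℝ
mkℝ s cs +ℝ mkℝ t ct = mkℝ (λ n → s n + t n) (oneSided⇒cauchy (λ n → s n + t n) sum-cauchy)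
  where
  open +-*-Solver
  sum-cauchy : ∀ ε → 0ℚ < ε →
    ∃[ N ] (∀ m n → N ℕ.≤ m → N ℕ.≤ n → (s m + t m) - (s n + t n) ≤ ε)
  sum-cauchy ε 0<ε = N ℕ.⊔ M , λ m n m≥ n≥ → subst₂ _≤_
    (solve 4 (λ a b c d → (a :- b) :+ (c :- d) := (a :+ c) :- (b :+ d)) refl (s m) (s n) (t m) (t n))
    (half ε)
    (+-mono-≤ (b m n (ℕ.≤-trans (ℕ.m≤m⊔n N M) m≥) (ℕ.≤-trans (ℕ.m≤m⊔n N M) n≥))
              (c m n (ℕ.≤-trans (ℕ.m≤n⊔m N M) m≥) (ℕ.≤-trans (ℕ.m≤n⊔m N M) n≥)))
    where
    left  = cauchy⇒oneSided s cs (½ * ε) (0<half 0<ε)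
    right = cauchy⇒oneSided t ct (½ * ε) (0<half 0<ε)
    N = proj₁ left
    M = proj₁ right
    b = proj₂ left
    c = proj₂ right

infix 8 -ℝ_
-ℝ_ : ℝ → ℝ
-ℝ mkℝ s cs = mkℝ (λ n → - s n) λ ε 0<ε → proj₁ (cs ε 0<ε) , λ m n m≥ n≥ →
  subst (_≤ ε)
    (trans (sym (∣-p∣≡∣p∣ (s m - s n))) (cong ∣_∣ (neg-distrib-+ (s m) (- s n))))
    (proj₂ (cs ε 0<ε) m n m≥ n≥)

infixr 7 _·_
_·_ : ℚ → ℝ → ℝ
q · mkℝ s cs = mkℝ (λ n → q * s n) scale-cauchy
  where
  open +-*-Solver
  scale-cauchy : IsCauchy (λ n → q * s n)
  scale-cauchy ε 0<ε = N , λ m n m≥ n≥ → begin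
    ∣ q * s m - q * s n ∣         ≡⟨ cong ∣_∣ (solve 3 (λ q a b → q :* a :- q :* b := q :* (a :- b)) refl q (s m) (s n)) ⟩
    ∣ q * (s m - s n) ∣           ≡⟨ ∣p*q∣≡∣p∣*∣q∣ q (s m - s n) ⟩
    ∣ q ∣ * ∣ s m - s n ∣         ≤⟨ *-mono (0≤∣p∣ q) (0≤∣p∣ _) (≤-trans ∣q∣≤k (ι-mono (ℕ.n≤1+n k))) (b m n m≥ n≥) ⟩
    ι (suc k) * (inv k * ε)       ≡⟨ *-assoc (ι (suc k)) (inv k) ε ⟨
    ι (suc k) * inv k * ε         ≡⟨ cong (_* ε) (ι-inv k) ⟩
    1ℚ * ε                        ≡⟨ *-identityˡ ε ⟩
    ε                             ∎
    where
    open ≤-Reasoning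
    k = proj₁ (archimedean ∣ q ∣)
    ∣q∣≤k = proj₂ (archimedean ∣ q ∣)
    N = proj₁ (cs (inv k * ε) (0<* (0<inv k) 0<ε))
    b = proj₂ (cs (inv k * ε) (0<* (0<inv k) 0<ε))

harmonic : ℕ → ℚ
harmonic zero    = 0ℚ
harmonic (suc n) = harmonic n + inv n

-- Σ 1/j over b(n+1) < j ≤ a(n+1), oriented (negative when a < b).
logSeq : ℕ → ℕ → ℕ → ℚ
logSeq a b n = harmonic (a ℕ.* suc n) - harmonic (b ℕ.* suc n)

harmonic-mono : ∀ x m → harmonic x ≤ harmonic (m ℕ.+ x)
harmonic-mono x zero    = ≤-refl
harmonic-mono x (suc m) = ≤-trans (harmonic-mono x m) (≤-by (inv (m ℕ.+ x)) refl (0≤inv (m ℕ.+ x)))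

block-upper : ∀ x m → ι x * (harmonic (m ℕ.+ x) - harmonic x) ≤ ι m
block-upper x zero = ≤-reflexive (trans (cong (ι x *_) (+-inverseʳ (harmonic x))) (*-zeroʳ (ι x)))
block-upper x (suc m) = begin
  ι x * (harmonic (m ℕ.+ x) + i - harmonic x)       ≡⟨ solve 4 (λ x h i k → x :* (h :+ i :- k) := x :* i :+ x :* (h :- k)) refl (ι x) (harmonic (m ℕ.+ x)) i (harmonic x) ⟩
  ι x * i + ι x * (harmonic (m ℕ.+ x) - harmonic x) ≤⟨ +-mono-≤ (*-monoʳ (0≤inv (m ℕ.+ x)) (ι-mono (ℕ.≤-trans (ℕ.m≤n+m x m) (ℕ.n≤1+n _)))) (block-upper x m) ⟩
  ι (suc (m ℕ.+ x)) * i + ι m                       ≡⟨ cong (_+ ι m) (ι-inv (m ℕ.+ x)) ⟩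
  1ℚ + ι m                                          ≡⟨ ι-suc m ⟨
  ι (suc m)                                         ∎
  where
  open ≤-Reasoning
  open +-*-Solver
  i = inv (m ℕ.+ x)

block-lower : ∀ x m → ι m ≤ ι (m ℕ.+ x) * (harmonic (m ℕ.+ x) - harmonic x)
block-lower x zero = ≤-reflexive (sym (trans (cong (ι x *_) (+-inverseʳ (harmonic x))) (*-zeroʳ (ι x))))
block-lower x (suc m) = begin
  ι (suc m)                                    ≡⟨ ι-suc m ⟩
  1ℚ + ι m                                     ≤⟨ +-monoʳ-≤ 1ℚ (block-lower x m) ⟩
  1ℚ + ι (m ℕ.+ x) * d                         ≤⟨ +-monoʳ-≤ 1ℚ (*-monoʳ (0≤- (harmonic-mono x m)) (ι-mono (ℕ.n≤1+n (m ℕ.+ x)))) ⟩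
  1ℚ + ι (suc (m ℕ.+ x)) * d                   ≡⟨ cong (_+ ι (suc (m ℕ.+ x)) * d) (ι-inv (m ℕ.+ x)) ⟨
  ι (suc (m ℕ.+ x)) * i + ι (suc (m ℕ.+ x)) * d ≡⟨ solve 4 (λ y h i k → y :* i :+ y :* (h :- k) := y :* (h :+ i :- k)) refl (ι (suc (m ℕ.+ x))) (harmonic (m ℕ.+ x)) i (harmonic x) ⟩
  ι (suc (m ℕ.+ x)) * (harmonic (m ℕ.+ x) + i - harmonic x) ∎
  where
  open ≤-Reasoning
  open +-*-Solver
  i = inv (m ℕ.+ x)
  d = harmonic (m ℕ.+ x) - harmonic x

-- stretch M k is the sum of 1/j over k < j ≤ k (M + 1).
stretch : ℕ → ℕ → ℚ
stretch M k = harmonic (k ℕ.* suc M) - harmonic k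

module _ (M : ℕ) where
  private
    block : ℕ → ℚ
    block k = harmonic (suc k ℕ.* suc M) - harmonic (k ℕ.* suc M)

    rescale : ∀ k d → ι (k ℕ.* suc M) * d ≡ ι (suc M) * (ι k * d)
    rescale k d = trans (cong (_* d) (ι-* k (suc M)))
      (solve 3 (λ k m d → k :* m :* d := m :* (k :* d)) refl (ι k) (ι (suc M)) d)
      where open +-*-Solver

    block≥ : ∀ k → inv k ≤ block k
    block≥ k = ι*-cancel k (ι*-cancel M (begin
      ι (suc M) * (ι (suc k) * inv k)  ≡⟨ cong (ι (suc M) *_) (ι-inv k) ⟩
      ι (suc M) * 1ℚ                   ≡⟨ *-identityʳ _ ⟩
      ι (suc M)                        ≤⟨ block-lower (k ℕ.* suc M) (suc M) ⟩
      ι (suc k ℕ.* suc M) * block k    ≡⟨ rescale (suc k) (block k) ⟩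
      ι (suc M) * (ι (suc k) * block k) ∎))
      where open ≤-Reasoning

    block≤ : ∀ k → block (suc k) ≤ inv k
    block≤ k = ι*-cancel k (ι*-cancel M (begin
      ι (suc M) * (ι (suc k) * block (suc k)) ≡⟨ rescale (suc k) (block (suc k)) ⟨
      ι (suc k ℕ.* suc M) * block (suc k)     ≤⟨ block-upper (suc k ℕ.* suc M) (suc M) ⟩
      ι (suc M)                               ≡⟨ *-identityʳ _ ⟨
      ι (suc M) * 1ℚ                          ≡⟨ cong (ι (suc M) *_) (ι-inv k) ⟨
      ι (suc M) * (ι (suc k) * inv k)         ∎))
      where open ≤-Reasoning

    step : ∀ k → stretch M (suc k) ≡ stretch M k + (block k - inv k)
    step k = solve 4 (λ H h i g → H :- (h :+ i) := (g :- h) :+ ((H :- g) :- i)) refl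
      (harmonic (suc k ℕ.* suc M)) (harmonic k) (inv k) (harmonic (k ℕ.* suc M))
      where open +-*-Solver

  stretch-mono : ∀ b m → stretch M b ≤ stretch M (m ℕ.+ b)
  stretch-mono b zero    = ≤-refl
  stretch-mono b (suc m) = ≤-trans (stretch-mono b m)
    (≤-by _ (sym (step (m ℕ.+ b))) (0≤- (block≥ (m ℕ.+ b))))

  stretch-antimono : ∀ b m → stretch M (suc (m ℕ.+ b)) + inv (m ℕ.+ b) ≤ stretch M (suc b) + inv b
  stretch-antimono b zero    = ≤-refl
  stretch-antimono b (suc m) = ≤-trans
    (≤-by _ (trans (cong (λ z → z + inv k′ + (inv k - block k′)) (step k′))
        (solve 4 (λ s B j i → s :+ (B :- j) :+ j :+ (i :- B) := s :+ i) refl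
          (stretch M k′) (block k′) (inv k′) (inv k)))
      (0≤- (block≤ k)))
    (stretch-antimono b m)
    where
    open +-*-Solver
    k  = m ℕ.+ b
    k′ = suc k

  stretch-osc : ∀ b c m → inv b ≤ inv m → inv c ≤ inv m →
    stretch M (suc b) - stretch M (suc c) ≤ inv m
  stretch-osc b c m b≥ c≥ = [ above , below ]′ (ℕ.≤-total c b)
    where
    open +-*-Solver
    p = stretch M (suc c) + inv c
    q = stretch M (suc b) + inv b
    above : c ℕ.≤ b → stretch M (suc b) - stretch M (suc c) ≤ inv m
    above c≤b = ≤-trans (≤-by (p - q + inv b)
        (solve 4 (λ s t i j → (s :- t) :+ ((t :+ j) :- (s :+ i) :+ i) := j) refl
          (stretch M (suc b)) (stretch M (suc c)) (inv b) (inv c))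
        (0≤+ (0≤- anti) (0≤inv b))) c≥
      where
      anti : q ≤ p
      anti = subst (λ z → stretch M (suc z) + inv z ≤ p) (ℕ.m∸n+n≡m c≤b) (stretch-antimono c (b ℕ.∸ c))
    below : b ℕ.≤ c → stretch M (suc b) - stretch M (suc c) ≤ inv m
    below b≤c = ≤-trans (≤-by (stretch M (suc c) - stretch M (suc b))
        (solve 2 (λ s t → (s :- t) :+ (t :- s) := con 0ℚ) refl (stretch M (suc b)) (stretch M (suc c)))
        (0≤- mono)) (0≤inv m)
      where
      mono : stretch M (suc b) ≤ stretch M (suc c)
      mono = subst (λ z → stretch M (suc b) ≤ stretch M z)
        (trans (ℕ.+-suc (c ℕ.∸ b) b) (cong suc (ℕ.m∸n+n≡m b≤c)))
        (stretch-mono (suc b) (c ℕ.∸ b))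

-- logSeq at index n is compared with logSeq along the refined mesh 1/((n+1)(m+1)).
logSeq-refine : ∀ a b n M → logSeq (suc a) (suc b) (M ℕ.+ n ℕ.* suc M) - logSeq (suc a) (suc b) n
  ≡ stretch M (suc a ℕ.* suc n) - stretch M (suc b ℕ.* suc n)
logSeq-refine a b n M = trans
  (cong₂ (λ x y → harmonic x - harmonic y - logSeq (suc a) (suc b) n)
    (sym (ℕ.*-assoc (suc a) (suc n) (suc M))) (sym (ℕ.*-assoc (suc b) (suc n) (suc M))))
  (solve 4 (λ A B x y → A :- B :- (x :- y) := (A :- x) :- (B :- y)) refl
    (harmonic (suc a ℕ.* suc n ℕ.* suc M)) (harmonic (suc b ℕ.* suc n ℕ.* suc M))
    (harmonic (suc a ℕ.* suc n)) (harmonic (suc b ℕ.* suc n)))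
  where open +-*-Solver

logSeq-close : ∀ a b m n → logSeq (suc a) (suc b) m - logSeq (suc a) (suc b) n ≤ inv m + inv n
logSeq-close a b m n = begin
  s m - s n                                ≡⟨ solve 3 (λ x y z → x :- y := (x :- z) :+ (z :- y)) refl (s m) (s n) (s r) ⟩
  (s m - s r) + (s r - s n)                ≤⟨ +-mono-≤ le₁ le₂ ⟩
  inv m + inv n                            ∎
  where
  open ≤-Reasoning
  open +-*-Solver
  s = logSeq (suc a) (suc b)
  r = n ℕ.+ m ℕ.* suc n
  osc : ∀ c d i j → stretch j (suc c ℕ.* suc i) - stretch j (suc d ℕ.* suc i) ≤ inv i
  osc c d i j = stretch-osc j (i ℕ.+ c ℕ.* suc i) (i ℕ.+ d ℕ.* suc i) i
    (inv-antimono (ℕ.m≤m+n i _)) (inv-antimono (ℕ.m≤m+n i _))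
  le₁ : s m - s r ≤ inv m
  le₁ = subst (_≤ inv m) (trans (sym (neg-- (stretch n (suc a ℕ.* suc m)) (stretch n (suc b ℕ.* suc m)))) (trans (cong -_ (sym (logSeq-refine a b m n))) (neg-- (s r) (s m))))
    (osc b a m n)
  r-sym : m ℕ.+ n ℕ.* suc m ≡ r
  r-sym = ℕ.suc-injective (ℕ.*-comm (suc n) (suc m))
  le₂ : s r - s n ≤ inv n
  le₂ = subst (_≤ inv n) (trans (sym (logSeq-refine a b n m)) (cong (λ z → s z - s n) r-sym)) (osc a b n m)

abstract
  logSeq-cauchy : ∀ a b → IsCauchy (logSeq (suc a) (suc b))
  logSeq-cauchy a b = oneSided⇒cauchy (logSeq (suc a) (suc b)) λ ε 0<ε → let N , le = inv-small (½ * ε) (0<half 0<ε) in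
    N , λ m n m≥ n≥ → ≤-trans (logSeq-close a b m n) (subst (inv m + inv n ≤_) (half ε)
      (+-mono-≤ (≤-trans (inv-antimono m≥) le) (≤-trans (inv-antimono n≥) le)))

-- For q = a/b > 0 in lowest terms, log q = ∫_b^a dt/t, as the limit of the
-- right Riemann sums of mesh 1/(n+1).  The value for q ≤ 0 is junk.
log : ℚ → ℝ
log (mkℚ ℤ.+[1+ a ] b _) = mkℝ (logSeq (suc a) (suc b)) (logSeq-cauchy a b)
log (mkℚ ℤ.+0       _ _) = fromℚ 0ℚ
log (mkℚ ℤ.-[1+ _ ] _ _) = fromℚ 0ℚ

bernoulli : ∀ n t → 0ℚ ≤ 1ℚ + t → 1ℚ + ι n * t ≤ (1ℚ + t) ^ n
bernoulli zero    t 0≤1+t = ≤-reflexive (trans (cong (λ z → 1ℚ + z) (*-zeroˡ t)) (+-identityʳ 1ℚ))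
bernoulli (suc n) t 0≤1+t = begin
  1ℚ + ι (suc n) * t       ≡⟨ cong (λ z → 1ℚ + z * t) (ι-suc n) ⟩
  1ℚ + (1ℚ + ι n) * t      ≤⟨ ≤-by (ι n * (t * t))
      (solve 2 (λ n t → con 1ℚ :+ (con 1ℚ :+ n) :* t :+ n :* (t :* t) := (con 1ℚ :+ t) :* (con 1ℚ :+ n :* t)) refl (ι n) t)
      (0≤* (0≤ι n) (0≤sq t)) ⟩
  (1ℚ + t) * (1ℚ + ι n * t) ≤⟨ *-monoˡ 0≤1+t (bernoulli n t 0≤1+t) ⟩
  (1ℚ + t) ^ suc n         ∎
  where
  open ≤-Reasoning
  open +-*-Solver
  0≤sq : ∀ t → 0ℚ ≤ t * t
  0≤sq t with ≤-total 0ℚ t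
  ... | inj₁ 0≤t = 0≤* 0≤t 0≤t
  ... | inj₂ t≤0 = subst (0ℚ ≤_) (solve 1 (λ t → (con 0ℚ :- t) :* (con 0ℚ :- t) := t :* t) refl t)
                     (0≤* (0≤- t≤0) (0≤- t≤0))

0≤^ : ∀ {x} n → 0ℚ ≤ x → 0ℚ ≤ x ^ n
0≤^ zero    0≤x = 0≤1
0≤^ (suc n) 0≤x = 0≤* 0≤x (0≤^ n 0≤x)

^-mono : ∀ {x y} n → 0ℚ ≤ x → x ≤ y → x ^ n ≤ y ^ n
^-mono zero    0≤x x≤y = ≤-refl
^-mono (suc n) 0≤x x≤y = *-mono 0≤x (0≤^ n 0≤x) x≤y (^-mono n 0≤x x≤y)

^≤1 : ∀ {x} n → 0ℚ ≤ x → x ≤ 1ℚ → x ^ n ≤ 1ℚ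
^≤1 zero    0≤x x≤1 = ≤-refl
^≤1 (suc n) 0≤x x≤1 = ≤-trans (*-mono 0≤x (0≤^ n 0≤x) x≤1 (^≤1 n 0≤x x≤1)) (≤-reflexive (*-identityˡ 1ℚ))

expApprox : ℚ → ℕ → ℚ
expApprox x n = (1ℚ + inv n * x) ^ suc n

expApprox-refine : ∀ x i j → 0ℚ ≤ 1ℚ + inv i * x →
  (0ℚ ≤ 1ℚ + inv i * inv j * x) ×
  (expApprox x i ≤ (1ℚ + inv i * inv j * x) ^ (suc j ℕ.* suc i))
expApprox-refine x i j 0≤ = 0≤1+t , (begin
  (1ℚ + inv i * x) ^ suc i                 ≤⟨ ^-mono (suc i) 0≤ (subst (_≤ (1ℚ + t) ^ suc j) eq₁ (bernoulli (suc j) t 0≤1+t)) ⟩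
  ((1ℚ + t) ^ suc j) ^ suc i               ≡⟨ ^-assocʳ (1ℚ + t) (suc j) (suc i) ⟩
  (1ℚ + t) ^ (suc j ℕ.* suc i)             ∎)
  where
  open ≤-Reasoning
  open +-*-Solver
  t = inv i * inv j * x
  eq₁ : 1ℚ + ι (suc j) * t ≡ 1ℚ + inv i * x
  eq₁ = trans (solve 4 (λ J k l x → con 1ℚ :+ J :* (k :* l :* x) := con 1ℚ :+ (J :* l) :* (k :* x)) refl (ι (suc j)) (inv i) (inv j) x)
    (trans (cong (λ z → 1ℚ + z * (inv i * x)) (ι-inv j)) (cong (λ z → 1ℚ + z) (*-identityˡ (inv i * x))))
  0≤1+t : 0ℚ ≤ 1ℚ + t
  0≤1+t = subst (0ℚ ≤_)
    (solve 3 (λ k l x → (con 1ℚ :- l) :+ l :* (con 1ℚ :+ k :* x) := con 1ℚ :+ k :* l :* x) refl (inv i) (inv j) x)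
    (0≤+ (0≤- (inv≤1 j)) (0≤* (0≤inv j) 0≤))

expApprox-cross : ∀ x y i j δ → 0ℚ ≤ 1ℚ + inv i * x → 0ℚ ≤ 1ℚ + inv j * y →
  0ℚ ≤ δ → δ ≤ 1ℚ → x + y + inv i * inv j * (x * y) ≤ δ →
  expApprox x i * expApprox y j * (1ℚ - δ) ≤ 1ℚ
expApprox-cross x y i j δ 0≤x 0≤y 0≤δ δ≤1 le = begin
  expApprox x i * expApprox y j * (1ℚ - δ)
    ≤⟨ *-monoʳ (0≤- δ≤1) (*-mono (0≤^ (suc i) 0≤x) (0≤^ (suc j) 0≤y) (proj₂ rx) (subst₂ (λ z L → expApprox y j ≤ (1ℚ + z * y) ^ L) (*-comm (inv j) (inv i)) (ℕ.*-comm (suc i) (suc j)) (proj₂ ry))) ⟩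
  A ^ L * B ^ L * (1ℚ - δ)
    ≡⟨ cong (_* (1ℚ - δ)) (^-distrib-* A B L) ⟨
  (A * B) ^ L * (1ℚ - δ)
    ≤⟨ *-mono (0≤^ L (0≤* 0≤A 0≤B)) (0≤- δ≤1) (^-mono L (0≤* 0≤A 0≤B) AB≤) 1-δ≤ ⟩
  (1ℚ + w * δ) ^ L * (1ℚ - w * δ) ^ L
    ≡⟨ ^-distrib-* (1ℚ + w * δ) (1ℚ - w * δ) L ⟨
  ((1ℚ + w * δ) * (1ℚ - w * δ)) ^ L
    ≤⟨ ^≤1 L (0≤* (0≤+ 0≤1 0≤wδ) (0≤- wδ≤1)) (≤-by (w * δ * (w * δ))
        (solve 1 (λ u → (con 1ℚ :+ u) :* (con 1ℚ :- u) :+ u :* u := con 1ℚ) refl (w * δ)) (0≤* 0≤wδ 0≤wδ)) ⟩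
  1ℚ ∎
  where
  open ≤-Reasoning
  open +-*-Solver
  w = inv i * inv j
  L = suc j ℕ.* suc i
  A = 1ℚ + w * x
  B = 1ℚ + w * y
  rx = expApprox-refine x i j 0≤x
  ry = expApprox-refine y j i 0≤y
  0≤w : 0ℚ ≤ w
  0≤w = 0≤* (0≤inv i) (0≤inv j)
  0≤A : 0ℚ ≤ A
  0≤A = proj₁ rx
  0≤B : 0ℚ ≤ B
  0≤B = subst (λ z → 0ℚ ≤ 1ℚ + z * y) (*-comm (inv j) (inv i)) (proj₁ ry)
  0≤wδ : 0ℚ ≤ w * δ
  0≤wδ = 0≤* 0≤w 0≤δ
  wδ≤1 : w * δ ≤ 1ℚ
  wδ≤1 = *-mono 0≤w 0≤δ (*-mono (0≤inv i) (0≤inv j) (inv≤1 i) (inv≤1 j)) δ≤1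
  AB≤ : A * B ≤ 1ℚ + w * δ
  AB≤ = subst (_≤ 1ℚ + w * δ)
    (solve 3 (λ w x y → con 1ℚ :+ w :* (x :+ y :+ w :* (x :* y)) := (con 1ℚ :+ w :* x) :* (con 1ℚ :+ w :* y)) refl w x y)
    (+-monoʳ-≤ 1ℚ (*-monoˡ 0≤w le))
  L*w : ι L * w ≡ 1ℚ
  L*w = trans (cong (_* w) (ι-* (suc j) (suc i)))
    (trans (solve 4 (λ J I i j → J :* I :* (i :* j) := (J :* j) :* (I :* i)) refl (ι (suc j)) (ι (suc i)) (inv i) (inv j))
    (cong₂ _*_ (ι-inv j) (ι-inv i)))
  1-δ≤ : 1ℚ - δ ≤ (1ℚ - w * δ) ^ L
  1-δ≤ = subst (_≤ (1ℚ - w * δ) ^ L)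
    (trans (solve 3 (λ L w d → con 1ℚ :+ L :* (:- (w :* d)) := con 1ℚ :- (L :* w) :* d) refl (ι L) w δ)
      (trans (cong (λ z → 1ℚ - z * δ) L*w) (cong (λ z → 1ℚ - z) (*-identityˡ δ))))
    (bernoulli L (- (w * δ)) (0≤- wδ≤1))

expApprox-neg : ∀ y j → 0ℚ ≤ 1ℚ + inv j * y → 0ℚ ≤ 1ℚ + inv j * - y →
  1ℚ - inv j * (y * y) ≤ expApprox y j * expApprox (- y) j
expApprox-neg y j 0≤+y 0≤-y = begin
  1ℚ - inv j * (y * y)                        ≡⟨ eq ⟨
  1ℚ + ι (suc j) * t                          ≤⟨ bernoulli (suc j) t (subst (0ℚ ≤_) eq′ (0≤* 0≤+y 0≤-y)) ⟩
  (1ℚ + t) ^ suc j                            ≡⟨ cong (_^ suc j) eq′ ⟨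
  ((1ℚ + inv j * y) * (1ℚ + inv j * - y)) ^ suc j ≡⟨ ^-distrib-* (1ℚ + inv j * y) (1ℚ + inv j * - y) (suc j) ⟩
  expApprox y j * expApprox (- y) j           ∎
  where
  open ≤-Reasoning
  open +-*-Solver
  t = - (inv j * (inv j * (y * y)))
  eq : 1ℚ + ι (suc j) * t ≡ 1ℚ - inv j * (y * y)
  eq = trans (solve 3 (λ J j y → con 1ℚ :+ J :* (:- (j :* (j :* (y :* y)))) := con 1ℚ :- (J :* j) :* (j :* (y :* y))) refl (ι (suc j)) (inv j) y)
    (trans (cong (λ z → 1ℚ - z * (inv j * (y * y))) (ι-inv j)) (cong (λ z → 1ℚ - z) (*-identityˡ (inv j * (y * y)))))
  eq′ : (1ℚ + inv j * y) * (1ℚ + inv j * - y) ≡ 1ℚ + t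
  eq′ = solve 2 (λ j y → (con 1ℚ :+ j :* y) :* (con 1ℚ :+ j :* (:- y)) := con 1ℚ :+ (:- (j :* (j :* (y :* y))))) refl (inv j) y

module _ (B : ℚ) (1≤B : 1ℚ ≤ B) (θ : ℚ) (0≤θ : 0ℚ ≤ θ) (θ≤1 : θ ≤ 1ℚ) where
  private
    ½θ≤θ : ½ * θ ≤ θ
    ½θ≤θ = ≤-by (½ * θ) (half θ) (0≤* (nonNegative⁻¹ ½) 0≤θ)

    0≤B : 0ℚ ≤ B
    0≤B = ≤-trans 0≤1 1≤B

    positive-base : ∀ x i → 0ℚ ≤ B + x → inv i * (B * B) ≤ ½ * θ → 0ℚ ≤ 1ℚ + inv i * x
    positive-base x i 0≤B+x iB = subst (0ℚ ≤_)
      (solve 3 (λ i x B → (con 1ℚ :- i :* (B :* B)) :+ i :* (B :* (B :- con 1ℚ)) :+ i :* (B :+ x) := con 1ℚ :+ i :* x) refl (inv i) x B)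
      (0≤+ (0≤+ (0≤- (≤-trans iB (≤-trans ½θ≤θ θ≤1))) (0≤* (0≤inv i) (0≤* 0≤B (0≤- 1≤B)))) (0≤* (0≤inv i) 0≤B+x))
      where open +-*-Solver

  expApprox-near : ∀ x z i j → 0ℚ ≤ B - x → 0ℚ ≤ B + x → 0ℚ ≤ B - z → 0ℚ ≤ B + z →
    x - z ≤ ½ * θ → inv i * (B * B) ≤ ½ * θ → inv j * (B * B) ≤ ½ * θ →
    0ℚ ≤ expApprox x i × expApprox x i * ((1ℚ - θ) * (1ℚ - θ)) ≤ expApprox z j
  expApprox-near x z i j B-x B+x B-z B+z x-z iB jB = 0≤a , (begin
    a * ((1ℚ - θ) * (1ℚ - θ))  ≤⟨ *-monoˡ 0≤a (*-monoˡ 0≤1-θ (≤-trans 1-θ≤ (expApprox-neg z j b+ b-))) ⟩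
    a * ((1ℚ - θ) * (b * c))   ≡⟨ solve 4 (λ a t b c → a :* (t :* (b :* c)) := b :* (a :* c :* t)) refl a (1ℚ - θ) b c ⟩
    b * (a * c * (1ℚ - θ))     ≤⟨ *-monoˡ 0≤b (expApprox-cross x (- z) i j θ b₀ b- 0≤θ θ≤1 cross) ⟩
    b * 1ℚ                     ≡⟨ *-identityʳ b ⟩
    b                          ∎)
    where
    open ≤-Reasoning
    open +-*-Solver
    a = expApprox x i
    b = expApprox z j
    c = expApprox (- z) j
    b₀ = positive-base x i B+x iB
    b+ = positive-base z j B+z jB
    b- = positive-base (- z) j B-z jB
    0≤a = 0≤^ (suc i) b₀
    0≤b = 0≤^ (suc j) b+
    0≤1-θ = 0≤- θ≤1
    1-θ≤ : 1ℚ - θ ≤ 1ℚ - inv j * (z * z)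
    1-θ≤ = ≤-by ((θ - inv j * (B * B)) + inv j * ((B - z) * (B + z)))
      (solve 4 (λ t j B z → con 1ℚ :- t :+ ((t :- j :* (B :* B)) :+ j :* ((B :- z) :* (B :+ z))) := con 1ℚ :- j :* (z :* z)) refl θ (inv j) B z)
      (0≤+ (0≤- (≤-trans jB ½θ≤θ)) (0≤* (0≤inv j) (0≤* B-z B+z)))
    cross : x - z + inv i * inv j * (x * - z) ≤ θ
    cross = ≤-by ((½ * θ - (x - z)) + ((½ * θ - inv j * (B * B)) + ((1ℚ - inv i) * (inv j * (B * B)) + inv i * inv j * (½ * ((B - x) * (B - z) + (B + x) * (B + z))))))
      (solve 6 (λ x z i j B t →
        x :- z :+ i :* j :* (x :* (:- z)) :+ ((con ½ :* t :- (x :- z)) :+ ((con ½ :* t :- j :* (B :* B)) :+ ((con 1ℚ :- i) :* (j :* (B :* B)) :+ i :* j :* (con ½ :* ((B :- x) :* (B :- z) :+ (B :+ x) :* (B :+ z)))))) := t) refl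
        x z (inv i) (inv j) B θ)
      (0≤+ (0≤- x-z) (0≤+ (0≤- jB) (0≤+ (0≤* (0≤- (inv≤1 i)) (0≤* (0≤inv j) (0≤* 0≤B 0≤B)))
        (0≤* (0≤* (0≤inv i) (0≤inv j)) (0≤* (nonNegative⁻¹ ½) (0≤+ (0≤* B-x B-z) (0≤* B+x B+z)))))))

cauchy-bounded : ∀ s → IsCauchy s →
  ∃[ b ] ∃[ N ] (∀ n → N ℕ.≤ n → 0ℚ ≤ ι (suc b) - s n × 0ℚ ≤ ι (suc b) + s n)
cauchy-bounded s cs = b , N , λ n n≥ →
    subst (0ℚ ≤_) (trans (solve 3 (λ B y x → (B :- y) :+ (con 1ℚ :- (x :- y)) := (con 1ℚ :+ B) :- x) refl (ι b) (s N) (s n)) (cong (_- s n) (sym (ι-suc b))))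
      (0≤+ (0≤- sN≤b) (0≤- (le n N n≥ ℕ.≤-refl)))
  , subst (0ℚ ≤_) (trans (solve 3 (λ B y x → (B :- (:- y)) :+ (con 1ℚ :- (y :- x)) := (con 1ℚ :+ B) :+ x) refl (ι b) (s N) (s n)) (cong (_+ s n) (sym (ι-suc b))))
      (0≤+ (0≤- -sN≤b) (0≤- (le N n ℕ.≤-refl n≥)))
  where
  open +-*-Solver
  one = cauchy⇒oneSided s cs 1ℚ (positive⁻¹ 1ℚ)
  N = proj₁ one
  le = proj₂ one
  arch = archimedean ∣ s N ∣
  b = proj₁ arch
  sN≤b : s N ≤ ι b
  sN≤b = ≤-trans (p≤∣p∣ (s N)) (proj₂ arch)
  -sN≤b : - s N ≤ ι b
  -sN≤b = ≤-trans (p≤∣p∣ (- s N)) (subst (_≤ ι b) (sym (∣-p∣≡∣p∣ (s N))) (proj₂ arch))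

inv-*-small : ∀ q ε → 0ℚ < ε → ∃[ N ] (∀ n → N ℕ.≤ n → inv n * q ≤ ε)
inv-*-small q ε 0<ε = N , λ n n≥ → begin
  inv n * q                ≤⟨ *-monoˡ (0≤inv n) (≤-trans q≤k (ι-mono (ℕ.n≤1+n k))) ⟩
  inv n * ι (suc k)        ≤⟨ *-monoʳ (0≤ι (suc k)) (≤-trans (inv-antimono n≥) small) ⟩
  inv k * ε * ι (suc k)    ≡⟨ solve 3 (λ i e k → i :* e :* k := k :* i :* e) refl (inv k) ε (ι (suc k)) ⟩
  ι (suc k) * inv k * ε    ≡⟨ cong (_* ε) (ι-inv k) ⟩
  1ℚ * ε                   ≡⟨ *-identityˡ ε ⟩
  ε                        ∎
  where
  open ≤-Reasoning
  open +-*-Solver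
  arch = archimedean q
  k = proj₁ arch
  q≤k = proj₂ arch
  sm = inv-small (inv k * ε) (0<* (0<inv k) 0<ε)
  N = proj₁ sm
  small = proj₂ sm

module _ (s : ℕ → ℚ) (cs : IsCauchy s) where
  private
    a : ℕ → ℚ
    a n = expApprox (s n) n

    window : ∀ θ → 0ℚ < θ → θ ≤ 1ℚ → ∃[ N ] (∀ i j → N ℕ.≤ i → N ℕ.≤ j →
      0ℚ ≤ a i × a i * ((1ℚ - θ) * (1ℚ - θ)) ≤ a j)
    window θ 0<θ θ≤1 = N , λ i j i≥ j≥ →
      expApprox-near B (ι-mono (ℕ.s≤s (ℕ.z≤n {b}))) θ (<⇒≤ 0<θ) θ≤1 (s i) (s j) i j
        (proj₁ (bd i (₁≤ i≥))) (proj₂ (bd i (₁≤ i≥)))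
        (proj₁ (bd j (₁≤ j≥))) (proj₂ (bd j (₁≤ j≥)))
        (near i j (₂≤ i≥) (₂≤ j≥)) (sm i (₃≤ i≥)) (sm j (₃≤ j≥))
      where
      bounds = cauchy-bounded s cs
      b  = proj₁ bounds
      B  = ι (suc b)
      N₁ = proj₁ (proj₂ bounds)
      bd = proj₂ (proj₂ bounds)
      N₂ = proj₁ (cauchy⇒oneSided s cs (½ * θ) (0<half 0<θ))
      near = proj₂ (cauchy⇒oneSided s cs (½ * θ) (0<half 0<θ))
      N₃ = proj₁ (inv-*-small (B * B) (½ * θ) (0<half 0<θ))
      sm = proj₂ (inv-*-small (B * B) (½ * θ) (0<half 0<θ))
      N = N₁ ℕ.⊔ (N₂ ℕ.⊔ N₃)
      ₁≤ : ∀ {n} → N ℕ.≤ n → N₁ ℕ.≤ n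
      ₁≤ = ℕ.≤-trans (ℕ.m≤m⊔n N₁ (N₂ ℕ.⊔ N₃))
      ₂≤ : ∀ {n} → N ℕ.≤ n → N₂ ℕ.≤ n
      ₂≤ n≥ = ℕ.≤-trans (ℕ.m≤m⊔n N₂ N₃) (ℕ.≤-trans (ℕ.m≤n⊔m N₁ (N₂ ℕ.⊔ N₃)) n≥)
      ₃≤ : ∀ {n} → N ℕ.≤ n → N₃ ℕ.≤ n
      ₃≤ n≥ = ℕ.≤-trans (ℕ.m≤n⊔m N₂ N₃) (ℕ.≤-trans (ℕ.m≤n⊔m N₁ (N₂ ℕ.⊔ N₃)) n≥)

    ¼ : ℚ
    ¼ = ½ * ½

    ¼≤1 : ¼ ≤ 1ℚ
    ¼≤1 = ≤-by (½ + ¼) refl (nonNegative⁻¹ (½ + ¼))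

    damp : ∀ x → 0ℚ ≤ x → let y = x * ((1ℚ - ¼) * (1ℚ - ¼)) in x + x ≤ y + y + (y + y)
    damp x 0≤x = ≤-by (¼ * x)
      (solve 1 (λ x → let y = x :* ((con 1ℚ :- con ¼) :* (con 1ℚ :- con ¼)) in
        x :+ x :+ con ¼ :* x := y :+ y :+ (y :+ y)) refl x)
      (0≤* (nonNegative⁻¹ ¼) 0≤x)
      where open +-*-Solver

    bounded : ∃[ k ] ∃[ N ] (∀ i → N ℕ.≤ i → a i + a i ≤ ι k)
    bounded = k , N , λ i i≥ →
      ≤-trans (damp (a i) (proj₁ (w i N i≥ ℕ.≤-refl)))
        (≤-trans (+-mono-≤ (dbl i i≥) (dbl i i≥)) (proj₂ arch))
      where
      N = proj₁ (window ¼ (positive⁻¹ ¼) ¼≤1)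
      w = proj₂ (window ¼ (positive⁻¹ ¼) ¼≤1)
      arch = archimedean (a N + a N + (a N + a N))
      k = proj₁ arch
      dbl : ∀ i → N ℕ.≤ i → let y = a i * ((1ℚ - ¼) * (1ℚ - ¼)) in y + y ≤ a N + a N
      dbl i i≥ = +-mono-≤ (proj₂ (w i N i≥ ℕ.≤-refl)) (proj₂ (w i N i≥ ℕ.≤-refl))

    gap : ∀ x y θ → 0ℚ ≤ θ → 0ℚ ≤ x → x * ((1ℚ - θ) * (1ℚ - θ)) ≤ y → x - y ≤ θ * (x + x)
    gap x y θ 0≤θ 0≤x le = ≤-by ((y - x * ((1ℚ - θ) * (1ℚ - θ))) + x * (θ * θ))
      (solve 3 (λ x y t → (x :- y) :+ ((y :- x :* ((con 1ℚ :- t) :* (con 1ℚ :- t))) :+ x :* (t :* t)) := t :* (x :+ x)) refl x y θ)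
      (0≤+ (0≤- le) (0≤* 0≤x (0≤* 0≤θ 0≤θ)))
      where open +-*-Solver

    0<⊓ : ∀ p q → 0ℚ < p → 0ℚ < q → 0ℚ < p ⊓ q
    0<⊓ p q 0<p 0<q = [ (λ eq → subst (0ℚ <_) (sym eq) 0<p) , (λ eq → subst (0ℚ <_) (sym eq) 0<q) ]′ (⊓-sel p q)

    oneSided : ∀ k N₁ → (∀ i → N₁ ℕ.≤ i → a i + a i ≤ ι k) →
      ∀ ε → 0ℚ < ε → ∃[ N ] (∀ m n → N ℕ.≤ m → N ℕ.≤ n → a m - a n ≤ ε)
    oneSided k N₁ bd ε 0<ε = N₁ ℕ.⊔ N₂ , λ m n m≥ n≥ → bound m n
      (ℕ.≤-trans (ℕ.m≤m⊔n N₁ N₂) m≥) (ℕ.≤-trans (ℕ.m≤n⊔m N₁ N₂) m≥) (ℕ.≤-trans (ℕ.m≤n⊔m N₁ N₂) n≥)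
      where
      open ≤-Reasoning
      open +-*-Solver
      θ = ¼ ⊓ (inv k * ε)
      0<θ : 0ℚ < θ
      0<θ = 0<⊓ ¼ (inv k * ε) (positive⁻¹ ¼) (0<* (0<inv k) 0<ε)
      win = window θ 0<θ (≤-trans (p⊓q≤p ¼ (inv k * ε)) ¼≤1)
      N₂ = proj₁ win
      bound : ∀ m n → N₁ ℕ.≤ m → N₂ ℕ.≤ m → N₂ ℕ.≤ n → a m - a n ≤ ε
      bound m n m≥₁ m≥₂ n≥₂ = begin
        a m - a n             ≤⟨ gap (a m) (a n) θ (<⇒≤ 0<θ) (proj₁ (proj₂ win m n m≥₂ n≥₂)) (proj₂ (proj₂ win m n m≥₂ n≥₂)) ⟩
        θ * (a m + a m)       ≤⟨ *-monoˡ (<⇒≤ 0<θ) (≤-trans (bd m m≥₁) (ι-mono (ℕ.n≤1+n k))) ⟩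
        θ * ι (suc k)         ≤⟨ *-monoʳ (0≤ι (suc k)) (p⊓q≤q ¼ (inv k * ε)) ⟩
        inv k * ε * ι (suc k) ≡⟨ solve 3 (λ i e k → i :* e :* k := k :* i :* e) refl (inv k) ε (ι (suc k)) ⟩
        ι (suc k) * inv k * ε ≡⟨ cong (_* ε) (ι-inv k) ⟩
        1ℚ * ε                ≡⟨ *-identityˡ ε ⟩
        ε                     ∎

  abstract
    exp-cauchy : IsCauchy a
    exp-cauchy = oneSided⇒cauchy a (oneSided (proj₁ bounded) (proj₁ (proj₂ bounded)) (proj₂ (proj₂ bounded)))

-- e^x as the limit of (1 + xₙ/(n+1))^(n+1).
exp : ℝ → ℝ
exp x = mkℝ (λ n → expApprox (seq x n) n) (exp-cauchy (seq x) (cauchy x))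

-- The primes of N repeated according to multiplicity.
primeFactors : ℕ → List ℕ
primeFactors zero        = []
primeFactors N@(suc _) = factors (factorise N)

distinctPrimes : ℕ → List ℕ
distinctPrimes N = deduplicate ℕ._≟_ (primeFactors N)

-- The exponent of the prime p in N.
ν : ℕ → ℕ → ℕ
ν p N = length (filter (p ℕ.≟_) (primeFactors N))

Ω : ℕ → ℕ
Ω N = length (primeFactors N)

-- The value at denominator 0, which only occurs for Ω N with N ≤ 1, is junk.
infixl 7 _÷ℕ_
_÷ℕ_ : ℕ → ℕ → ℚ
a ÷ℕ zero      = 0ℚ
a ÷ℕ b@(suc _) = ℤ.+ a / b

sumℝ : List ℝ → ℝ
sumℝ = foldr _+ℝ_ (fromℚ 0ℚ)

H : ℕ → ℝ
H N = -ℝ sumℝ (map (λ p → (ν p N ÷ℕ Ω N) · log (ν p N ÷ℕ Ω N)) (distinctPrimes N))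

ExponentialDivisor : ℕ → ℕ → Set
ExponentialDivisor d N = Σ (ℕ → ℕ) λ β →
  (∀ p → p ∈ distinctPrimes N → 1 ℕ.≤ β p × β p ∣ ν p N) ×
  d ≡ product (map (λ p → p ℕ.^ β p) (distinctPrimes N))

SquareFree : ℕ → Set
SquareFree n = ∀ d → d ℕ.* d ∣ n → d ≡ 1

{-# OPTIONS --safe #-}
module Submission where

-- Write A = Ω(n) and C = Σ aᵢ log aᵢ over the exponents aᵢ of n.  Then
-- H(n p^x) = log (A + x) - (C + x log x)/(A + x), and the log sum inequality gives
--   H(n p^y) - H(n p^x) ≥ (1/(A + x) - 1/(A + y)) (C - A log y).
-- If n is square-free then C = 0, and the right-hand side is non-negative for
-- y ≤ x.  The bound α ≤ A e^(-H(n)) says A log α ≤ C, which settles x = β ≤ y = α.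
-- Logarithms enter only through log (ab) = log a + log b and log u ≤ u - 1.

open import Defs
open import Data.Nat.Base using (ℕ; zero; suc)
open import Data.Product.Base using (∃-syntax; _×_; _,_; proj₁; proj₂)
open import Relation.Binary.PropositionalEquality using (_≡_; refl; sym; trans; cong; cong₂; subst; subst₂; module ≡-Reasoning)

-- As a function of a real variable, h(x) = log (A + x) - (C + x log x)/(A + x) has derivative (C -
-- A log x)/(A + x)². So h increases up to x₀ = e^(C/A) = A e^(-H(n)) and decreases afterwards: this
-- is the origin of the bound on α, and x₀ = 1 when n is square-free. Replacing log t by log y in
-- the integral of h′ from x to y gives the lower bound of the overview for either order of x and y,
-- because log is monotone. The log sum inequality reaches the same bound from two uses of log u ≤ u
-- - 1, without differentiation. Since reals are Cauchy sequences of rationals, the algebra is done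
-- by exact identities in ℚ at each index, and the errors that tend to 0 are tracked separately.

module Entropy where

  open import Algebra.Bundles using (CommutativeRing)
  import Data.Integer.Base as ℤ
  import Data.Integer.Properties as ℤ
  open import Data.List.Base using (List; []; _∷_; map; foldr)
  open import Data.List.Relation.Unary.All using (All; []; _∷_)
  import Data.Nat.Base as ℕ
  open import Data.Nat.ListAction using (sum)
  import Data.Nat.Properties as ℕ
  open import Data.Rational.Base
  open import Data.Rational.Properties
  open import Data.Rational.Solver using (module +-*-Solver)
  import Data.Rational.Unnormalised.Base as ℚᵘ
  import Data.Rational.Unnormalised.Properties as ℚᵘ
  open import Data.Sum.Base using (inj₁; inj₂; [_,_]′)
  open import Relation.Nullary using (contradiction)
  open import Algebra.Properties.CommutativeSemiring.Exp
    (CommutativeRing.commutativeSemiring +-*-commutativeRing)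
    using (_^_; ^-distrib-*)

  -- Asymptotic inequalities and null sequences of rationals.

  -- lim s ≥ 0, if the limit exists.
  record 0≲_ (s : ℕ → ℚ) : Set where
    constructor eventually
    field
      witness : ∀ ε → 0ℚ < ε → ∃[ N ] (∀ n → N ℕ.≤ n → 0ℚ ≤ s n + ε)
  open 0≲_

  infix 4 0≲_

  0≲-pos : ∀ {s} → (∀ n → 0ℚ ≤ s n) → 0≲ s
  witness (0≲-pos 0≤s) ε 0<ε = 0 , λ n _ → 0≤+ (0≤s n) (<⇒≤ 0<ε)

  0≲-cong : ∀ {s t} → (∀ n → s n ≡ t n) → 0≲ s → 0≲ t
  witness (0≲-cong s≡t 0≲s) ε 0<ε = let N , b = witness 0≲s ε 0<ε in
    N , λ n n≥ → subst (λ z → 0ℚ ≤ z + ε) (s≡t n) (b n n≥)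

  0≲-+ : ∀ {s t} → 0≲ s → 0≲ t → 0≲ λ n → s n + t n
  witness (0≲-+ {s} {t} 0≲s 0≲t) ε 0<ε = N ℕ.⊔ M , λ n n≥ → subst (0ℚ ≤_)
    (trans (solve 3 (λ s t e → (s :+ e) :+ (t :+ e) := (s :+ t) :+ (e :+ e)) refl (s n) (t n) (½ * ε))
      (cong (s n + t n +_) (half ε)))
    (0≤+ (b n (ℕ.≤-trans (ℕ.m≤m⊔n N M) n≥)) (c n (ℕ.≤-trans (ℕ.m≤n⊔m N M) n≥)))
    where
    open +-*-Solver
    N = proj₁ (witness 0≲s (½ * ε) (0<half 0<ε))
    b = proj₂ (witness 0≲s (½ * ε) (0<half 0<ε))
    M = proj₁ (witness 0≲t (½ * ε) (0<half 0<ε))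
    c = proj₂ (witness 0≲t (½ * ε) (0<half 0<ε))

  0≲-* : ∀ {s} q → 0ℚ ≤ q → 0≲ s → 0≲ λ n → q * s n
  witness (0≲-* {s} q 0≤q 0≲s) ε 0<ε = N , λ n n≥ → subst (0ℚ ≤_)
    (solve 4 (λ q s d e → q :* (s :+ d) :+ (e :- q :* d) := q :* s :+ e) refl q (s n) δ ε)
    (0≤+ (0≤* 0≤q (b n n≥)) (0≤- qδ≤ε))
    where
    open +-*-Solver
    k = proj₁ (archimedean q)
    δ = inv k * ε
    0<δ = 0<* (0<inv k) 0<ε
    N = proj₁ (witness 0≲s δ 0<δ)
    b = proj₂ (witness 0≲s δ 0<δ)
    open ≤-Reasoning
    qδ≤ε : q * δ ≤ ε
    qδ≤ε = begin
      q * δ                     ≤⟨ *-monoʳ (<⇒≤ 0<δ) (≤-trans (proj₂ (archimedean q)) (ι-mono (ℕ.n≤1+n k))) ⟩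
      ι (suc k) * (inv k * ε)   ≡⟨ *-assoc (ι (suc k)) (inv k) ε ⟨
      ι (suc k) * inv k * ε     ≡⟨ cong (_* ε) (ι-inv k) ⟩
      1ℚ * ε                    ≡⟨ *-identityˡ ε ⟩
      ε                         ∎

  0≲⇒≤ℝ : ∀ {x y} → 0≲ (λ n → seq y n - seq x n) → x ≤ℝ y
  0≲⇒≤ℝ {x} {y} 0≲y-x ε 0<ε = let N , b = witness 0≲y-x ε 0<ε in
    N , λ n n≥ → ≤-by (seq y n - seq x n + ε)
      (solve 3 (λ x y e → x :+ (y :- x :+ e) := y :+ e) refl (seq x n) (seq y n) ε) (b n n≥)
    where open +-*-Solver

  -- Equality of two limits is stated as nullity of the difference. No Cauchy property is asked for,
  -- so arbitrary rational expressions in approximants can be compared.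
  record Null (s : ℕ → ℚ) : Set where
    constructor _,_
    field
      lower : 0≲ s
      upper : 0≲ λ n → - s n
  open Null

  Null-0 : ∀ {s} → (∀ n → s n ≡ 0ℚ) → Null s
  Null-0 s≡0 = 0≲-pos (λ n → ≤-reflexive (sym (s≡0 n)))
             , 0≲-pos (λ n → ≤-reflexive (sym (cong -_ (s≡0 n))))

  Null-cong : ∀ {s t} → (∀ n → s n ≡ t n) → Null s → Null t
  Null-cong s≡t (l , u) = 0≲-cong s≡t l , 0≲-cong (λ n → cong -_ (s≡t n)) u

  Null-+ : ∀ {s t} → Null s → Null t → Null λ n → s n + t n
  Null-+ {s} {t} (l , u) (l′ , u′) = 0≲-+ l l′
    , 0≲-cong (λ n → sym (neg-distrib-+ (s n) (t n))) (0≲-+ u u′)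

  Null-neg : ∀ {s} → Null s → Null λ n → - s n
  Null-neg {s} (l , u) = u , 0≲-cong (λ n → solve 1 (λ x → x := :- (:- x)) refl (s n)) l
    where open +-*-Solver

  Null-* : ∀ {s} q → Null s → Null λ n → q * s n
  Null-* {s} q (l , u) with ≤-total 0ℚ q
  ... | inj₁ 0≤q = 0≲-* q 0≤q l
    , 0≲-cong (λ n → solve 2 (λ q x → q :* (:- x) := :- (q :* x)) refl q (s n)) (0≲-* q 0≤q u)
    where open +-*-Solver
  ... | inj₂ q≤0 = 0≲-cong (λ n → solve 2 (λ q x → (con 0ℚ :- q) :* (:- x) := q :* x) refl q (s n)) (0≲-* (0ℚ - q) (0≤- q≤0) u)
    , 0≲-cong (λ n → solve 2 (λ q x → (con 0ℚ :- q) :* x := :- (q :* x)) refl q (s n)) (0≲-* (0ℚ - q) (0≤- q≤0) l)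
    where open +-*-Solver

  subsequence-null : ∀ s (φ : ℕ → ℕ) → IsCauchy s → (∀ n → n ℕ.≤ φ n) → Null λ n → s (φ n) - s n
  subsequence-null s φ cs n≤φ =
      eventually (λ ε 0<ε → let N , b = cauchy⇒oneSided s cs ε 0<ε in
        N , λ n n≥ → subst (0ℚ ≤_) (solve 3 (λ x y e → e :- (x :- y) := y :- x :+ e) refl (s n) (s (φ n)) ε)
          (0≤- (b n (φ n) n≥ (ℕ.≤-trans n≥ (n≤φ n)))))
    , eventually (λ ε 0<ε → let N , b = cauchy⇒oneSided s cs ε 0<ε in
        N , λ n n≥ → subst (0ℚ ≤_) (solve 3 (λ x y e → e :- (y :- x) := :- (y :- x) :+ e) refl (s n) (s (φ n)) ε)
          (0≤- (b (φ n) n (ℕ.≤-trans n≥ (n≤φ n)) n≥)))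
    where open +-*-Solver

  -- Logarithms of natural numbers.

  L : ℕ → ℕ → ℚ
  L a = logSeq a 1

  L-1 : ∀ n → L 1 n ≡ 0ℚ
  L-1 n = +-inverseʳ (harmonic (1 ℕ.* suc n))

  -- Exact at every index, since the harmonic numbers telescope. It reduces logarithms of fractions
  -- to those of integers.
  logSeq≡L-L : ∀ a b n → logSeq a b n ≡ L a n - L b n
  logSeq≡L-L a b n = solve 3 (λ x y z → x :- y := (x :- z) :- (y :- z)) refl
    (harmonic (a ℕ.* suc n)) (harmonic (b ℕ.* suc n)) (harmonic (1 ℕ.* suc n))
    where open +-*-Solver

  -- On the mesh refined by the factor b, the approximant of log a is exactly `L (a * b) n - L b n`.
  -- Refining the mesh passes to later terms of a Cauchy sequence, which costs only a null error.
  -- The factors must be non-zero because `L 0` tends to -∞.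
  L-* : ∀ a b .{{_ : ℕ.NonZero a}} .{{_ : ℕ.NonZero b}} → Null λ n → L (a ℕ.* b) n - (L a n + L b n)
  L-* (suc a) (suc b) = Null-cong eq (subsequence-null (L (suc a)) φ (logSeq-cauchy a 0) n≤φ)
    where
    φ : ℕ → ℕ
    φ n = b ℕ.+ n ℕ.* suc b
    n≤φ : ∀ n → n ℕ.≤ φ n
    n≤φ n = ℕ.≤-trans (ℕ.m≤m*n n (suc b)) (ℕ.m≤n+m (n ℕ.* suc b) b)
    index₁ : ∀ n → suc a ℕ.* (suc n ℕ.* suc b) ≡ suc a ℕ.* suc b ℕ.* suc n
    index₁ n = trans (cong (suc a ℕ.*_) (ℕ.*-comm (suc n) (suc b))) (sym (ℕ.*-assoc (suc a) (suc b) (suc n)))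
    index₂ : ∀ n → 1 ℕ.* (suc n ℕ.* suc b) ≡ suc b ℕ.* suc n
    index₂ n = trans (ℕ.*-identityˡ (suc n ℕ.* suc b)) (ℕ.*-comm (suc n) (suc b))
    open +-*-Solver
    eq : ∀ n → L (suc a) (φ n) - L (suc a) n ≡ L (suc a ℕ.* suc b) n - (L (suc a) n + L (suc b) n)
    eq n = trans (cong₂ (λ x y → harmonic x - harmonic y - L (suc a) n) (index₁ n) (index₂ n))
      (solve 4 (λ x y z l → x :- y :- l := (x :- z) :- (l :+ (y :- z))) refl
        (harmonic (suc a ℕ.* suc b ℕ.* suc n)) (harmonic (suc b ℕ.* suc n)) (harmonic (1 ℕ.* suc n)) (L (suc a) n))

  L-mono : ∀ {a b} → a ℕ.≤ b → ∀ n → L a n ≤ L b n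
  L-mono {a} {b} a≤b n = +-monoˡ-≤ (- harmonic (1 ℕ.* suc n))
    (subst (λ z → harmonic (a ℕ.* suc n) ≤ harmonic z) (ℕ.m∸n+n≡m le) (harmonic-mono (a ℕ.* suc n) (b ℕ.* suc n ℕ.∸ a ℕ.* suc n)))
    where
    le : a ℕ.* suc n ℕ.≤ b ℕ.* suc n
    le = ℕ.*-monoˡ-≤ (suc n) a≤b

  -- This is log u ≤ u - 1 at u = a/b, cleared of denominators. It needs no error term: the Riemann
  -- sums use right endpoints, so each summand is at most 1/(b(n+1)) when b ≤ a, and at least that
  -- when a ≤ b, where the sum is subtracted.
  L-tangent : ∀ a b n → ι b * (L a n - L b n) ≤ ι a - ι b
  L-tangent a b n = ι*-cancel n ([ above , below ]′ (ℕ.≤-total b a))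
    where
    open ≤-Reasoning
    open +-*-Solver
    d : ℚ
    d = harmonic (a ℕ.* suc n) - harmonic (b ℕ.* suc n)
    scale : ι (suc n) * (ι b * (L a n - L b n)) ≡ ι (b ℕ.* suc n) * d
    scale = trans (cong (λ z → ι (suc n) * (ι b * z)) (sym (logSeq≡L-L a b n)))
      (trans (solve 3 (λ n b d → n :* (b :* d) := b :* n :* d) refl (ι (suc n)) (ι b) d)
        (cong (_* d) (sym (ι-* b (suc n)))))
    difference : ∀ {x y} → x ℕ.≤ y → ι ((y ℕ.∸ x) ℕ.* suc n) ≡ ι (suc n) * (ι y - ι x)
    difference {x} {y} x≤y = trans (ι-* (y ℕ.∸ x) (suc n))
      (trans (solve 3 (λ c x n → c :* n := n :* ((c :+ x) :- x)) refl (ι (y ℕ.∸ x)) (ι x) (ι (suc n)))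
        (cong (λ z → ι (suc n) * (z - ι x)) (trans (sym (ι-+ (y ℕ.∸ x) x)) (cong ι (ℕ.m∸n+n≡m x≤y)))))
    index : ∀ {x y} → x ℕ.≤ y → (y ℕ.∸ x) ℕ.* suc n ℕ.+ x ℕ.* suc n ≡ y ℕ.* suc n
    index {x} {y} x≤y = trans (sym (ℕ.*-distribʳ-+ (suc n) (y ℕ.∸ x) x)) (cong (ℕ._* suc n) (ℕ.m∸n+n≡m x≤y))
    above : b ℕ.≤ a → ι (suc n) * (ι b * (L a n - L b n)) ≤ ι (suc n) * (ι a - ι b)
    above b≤a = begin
      ι (suc n) * (ι b * (L a n - L b n))     ≡⟨ scale ⟩
      ι (b ℕ.* suc n) * d                     ≡⟨ cong (λ z → ι (b ℕ.* suc n) * (harmonic z - harmonic (b ℕ.* suc n))) (index b≤a) ⟨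
      ι (b ℕ.* suc n) * (harmonic ((a ℕ.∸ b) ℕ.* suc n ℕ.+ b ℕ.* suc n) - harmonic (b ℕ.* suc n))
                                              ≤⟨ block-upper (b ℕ.* suc n) ((a ℕ.∸ b) ℕ.* suc n) ⟩
      ι ((a ℕ.∸ b) ℕ.* suc n)                 ≡⟨ difference b≤a ⟩
      ι (suc n) * (ι a - ι b)                 ∎
    below : a ℕ.≤ b → ι (suc n) * (ι b * (L a n - L b n)) ≤ ι (suc n) * (ι a - ι b)
    below a≤b = begin
      ι (suc n) * (ι b * (L a n - L b n))     ≡⟨ scale ⟩
      ι (b ℕ.* suc n) * d                     ≡⟨ solve 3 (λ b x y → b :* (x :- y) := :- (b :* (y :- x))) refl (ι (b ℕ.* suc n)) (harmonic (a ℕ.* suc n)) (harmonic (b ℕ.* suc n)) ⟩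
      - (ι (b ℕ.* suc n) * (harmonic (b ℕ.* suc n) - harmonic (a ℕ.* suc n)))
                                              ≤⟨ neg-antimono-≤ lower-bound ⟩
      - (ι ((b ℕ.∸ a) ℕ.* suc n))             ≡⟨ cong -_ (difference a≤b) ⟩
      - (ι (suc n) * (ι b - ι a))             ≡⟨ solve 3 (λ n b a → :- (n :* (b :- a)) := n :* (a :- b)) refl (ι (suc n)) (ι b) (ι a) ⟩
      ι (suc n) * (ι a - ι b)                 ∎
      where
      lower-bound : ι ((b ℕ.∸ a) ℕ.* suc n) ≤ ι (b ℕ.* suc n) * (harmonic (b ℕ.* suc n) - harmonic (a ℕ.* suc n))
      lower-bound = subst (λ z → ι ((b ℕ.∸ a) ℕ.* suc n) ≤ ι z * (harmonic z - harmonic (a ℕ.* suc n))) (index a≤b)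
        (block-lower (a ℕ.* suc n) ((b ℕ.∸ a) ℕ.* suc n))

  -- `log` reads the fraction in lowest terms c/d. Cross-multiplication gives c(s+1) = (a+1)d, and
  -- `L-*` applied to both products compares the two representations.
  log-÷ : ∀ a s → Null λ n → seq (log (suc a ÷ℕ suc s)) n - (L (suc a) n - L (suc s) n)
  log-÷ a s = aux (suc a ÷ℕ suc s) (toℚᵘ-fromℚᵘ (ℚᵘ.mkℚᵘ (ℤ.+ suc a) s))
    where
    open +-*-Solver
    aux : ∀ q → toℚᵘ q ℚᵘ.≃ ℚᵘ.mkℚᵘ (ℤ.+ suc a) s → Null λ n → seq (log q) n - (L (suc a) n - L (suc s) n)
    aux (mkℚ ℤ.+0 d _) (ℚᵘ.*≡* ())
    aux (mkℚ ℤ.-[1+ c ] d _) (ℚᵘ.*≡* ())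
    aux (mkℚ ℤ.+[1+ c ] d _) (ℚᵘ.*≡* eq) = Null-cong pointwise
      (Null-+ (L-* (suc a) (suc d)) (Null-neg (subst (λ z → Null λ n → L z n - (L (suc c) n + L (suc s) n)) cs≡ad (L-* (suc c) (suc s)))))
      where
      cs≡ad : suc c ℕ.* suc s ≡ suc a ℕ.* suc d
      cs≡ad = ℤ.+-injective eq
      pointwise : ∀ n → (L (suc a ℕ.* suc d) n - (L (suc a) n + L (suc d) n)) + - (L (suc a ℕ.* suc d) n - (L (suc c) n + L (suc s) n))
        ≡ logSeq (suc c) (suc d) n - (L (suc a) n - L (suc s) n)
      pointwise n = trans
        (solve 5 (λ a d c s x → (x :- (a :+ d)) :+ :- (x :- (c :+ s)) := (c :- d) :- (a :- s)) refl
          (L (suc a) n) (L (suc d) n) (L (suc c) n) (L (suc s) n) (L (suc a ℕ.* suc d) n))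
        (cong (_- (L (suc a) n - L (suc s) n)) (sym (logSeq≡L-L (suc c) (suc d) n)))

  ÷ℕ≡*inv : ∀ a s → a ÷ℕ suc s ≡ ι a * inv s
  ÷ℕ≡*inv a s = toℚᵘ-injective (begin
    toℚᵘ (a ÷ℕ suc s)                              ≈⟨ toℚᵘ-fromℚᵘ (ℚᵘ.mkℚᵘ (ℤ.+ a) s) ⟩
    ℚᵘ.mkℚᵘ (ℤ.+ a) s                              ≈⟨ ℚᵘ.*≡* (cong₂ ℤ._*_ (sym (ℤ.*-identityʳ (ℤ.+ a))) (cong ℤ.+_ (ℕ.*-identityˡ (suc s)))) ⟩
    ℚᵘ.mkℚᵘ (ℤ.+ a) 0 ℚᵘ.* ℚᵘ.mkℚᵘ (ℤ.+ 1) s       ≈⟨ ℚᵘ.*-cong (toℚᵘ-fromℚᵘ (ℚᵘ.mkℚᵘ (ℤ.+ a) 0)) (toℚᵘ-fromℚᵘ (ℚᵘ.mkℚᵘ (ℤ.+ 1) s)) ⟨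
    toℚᵘ (ι a) ℚᵘ.* toℚᵘ (inv s)                   ≈⟨ toℚᵘ-homo-* (ι a) (inv s) ⟨
    toℚᵘ (ι a * inv s)                             ∎)
    where open ℚᵘ.≃-Reasoning

  -- From a bound by the exponential to a bound on the logarithm.

  L-^ : ∀ a k .{{_ : ℕ.NonZero a}} → Null λ n → L (a ℕ.^ k) n - ι k * L a n
  L-^ a zero    = Null-0 λ n → trans (cong₂ _-_ (L-1 n) (*-zeroˡ (L a n))) (+-inverseʳ 0ℚ)
  L-^ a (suc k) = Null-cong
    (λ n → trans (solve 4 (λ p q l k → p :- (l :+ q) :+ (q :- k :* l) := p :- (con 1ℚ :+ k) :* l) refl
        (L (a ℕ.* a ℕ.^ k) n) (L (a ℕ.^ k) n) (L a n) (ι k))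
      (cong (λ z → L (a ℕ.^ suc k) n - z * L a n) (sym (ι-suc k))))
    (Null-+ (L-* a (a ℕ.^ k)) (L-^ a k))
    where
    open +-*-Solver
    instance _ = ℕ.m^n≢0 a k

  ι-^ : ∀ a k → ι (a ℕ.^ k) ≡ ι a ^ k
  ι-^ a zero    = refl
  ι-^ a (suc k) = trans (ι-* a (a ℕ.^ k)) (cong (ι a *_) (ι-^ a k))

  ι-cancel-≤ : ∀ {a b} → ι a ≤ ι b → a ℕ.≤ b
  ι-cancel-≤ {a} {b} ιa≤ιb = ℕ.≮⇒≥ λ b<a → <-irrefl refl (<-≤-trans (ι-< b) (≤-trans (ι-mono b<a) ιa≤ιb))
    where
    ι-< : ∀ b → ι b < ι (suc b)
    ι-< b = subst₂ _<_ (+-identityˡ (ι b)) (sym (ι-suc b)) (+-monoˡ-< (ι b) (positive⁻¹ 1ℚ))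

  positive-fraction : ∀ u → 0ℚ < u → ∃[ c ] ∃[ d ] ι (suc c) ≡ ι (suc d) * u
  positive-fraction (mkℚ ℤ.+0 _ _) 0<u = contradiction 0<u (λ { (*<* (ℤ.+<+ ())) })
  positive-fraction (mkℚ ℤ.-[1+ _ ] _ _) (*<* ())
  positive-fraction u@(mkℚ ℤ.+[1+ c ] d _) _ = c , d , sym (begin
    ι (suc d) * u                         ≡⟨ cong (ι (suc d) *_) (trans (sym (↥p/↧p≡p u)) (÷ℕ≡*inv (suc c) d)) ⟩
    ι (suc d) * (ι (suc c) * inv d)       ≡⟨ solve 3 (λ d c i → d :* (c :* i) := c :* (d :* i)) refl (ι (suc d)) (ι (suc c)) (inv d) ⟩
    ι (suc c) * (ι (suc d) * inv d)       ≡⟨ cong (ι (suc c) *_) (ι-inv d) ⟩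
    ι (suc c) * 1ℚ                        ≡⟨ *-identityʳ (ι (suc c)) ⟩
    ι (suc c)                             ∎)
    where
    open ≡-Reasoning
    open +-*-Solver

  -- With u = C/D, the hypothesis becomes an inequality between integers,
  -- A (j+1) D^(n+1) ≤ B (j+2) C^(n+1); take logarithms and use log u ≤ u - 1.
  log≲power : ∀ a b j n u → 0ℚ < u → ι (suc a) ≤ ι (suc b) * u ^ suc n + inv (suc j) →
    0≲ λ k → ι (suc n) * (u - 1ℚ) + inv j - logSeq (suc a) (suc b) k
  log≲power a b j n u 0<u hyp = 0≲-cong pointwise
    (0≲-+ (0≲-pos nonneg) (0≲-+ (Null.upper right) (Null.lower left)))
    where
    open +-*-Solver
    c = proj₁ (positive-fraction u 0<u)
    d = proj₁ (proj₂ (positive-fraction u 0<u))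
    C≡Du = proj₂ (proj₂ (positive-fraction u 0<u))
    A = suc a
    B = suc b
    C = suc c
    D = suc d
    N = suc n
    J = suc j
    U = u ^ N
    lhs = A ℕ.* (J ℕ.* D ℕ.^ N)
    rhs = B ℕ.* (suc J ℕ.* C ℕ.^ N)

    left : Null λ k → L lhs k - (L A k + (L J k + ι N * L D k))
    left = Null-cong
      (λ k → solve 6 (λ p q r a j m → p :- (a :+ q) :+ (q :- (j :+ r) :+ (r :- m)) := p :- (a :+ (j :+ m))) refl
        (L lhs k) (L (J ℕ.* D ℕ.^ N) k) (L (D ℕ.^ N) k) (L A k) (L J k) (ι N * L D k))
      (Null-+ (L-* A (J ℕ.* D ℕ.^ N) {{_}} {{ℕ.m*n≢0 J (D ℕ.^ N) {{_}} {{ℕ.m^n≢0 D N}}}})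
        (Null-+ (L-* J (D ℕ.^ N) {{_}} {{ℕ.m^n≢0 D N}}) (L-^ D N)))

    right : Null λ k → L rhs k - (L B k + (L (suc J) k + ι N * L C k))
    right = Null-cong
      (λ k → solve 6 (λ p q r a j m → p :- (a :+ q) :+ (q :- (j :+ r) :+ (r :- m)) := p :- (a :+ (j :+ m))) refl
        (L rhs k) (L (suc J ℕ.* C ℕ.^ N) k) (L (C ℕ.^ N) k) (L B k) (L (suc J) k) (ι N * L C k))
      (Null-+ (L-* B (suc J ℕ.* C ℕ.^ N) {{_}} {{ℕ.m*n≢0 (suc J) (C ℕ.^ N) {{_}} {{ℕ.m^n≢0 C N}}}})
        (Null-+ (L-* (suc J) (C ℕ.^ N) {{_}} {{ℕ.m^n≢0 C N}}) (L-^ C N)))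

    -- Multiplying the hypothesis by J + 1 turns its additive slack 1/(J+1) into 1, which is at most
    -- A. The slack thus becomes the factor (J+1)/J.
    scaled : ι A * ι J ≤ ι B * ι (suc J) * U
    scaled = ≤-by (ι (suc J) * (ι B * U + inv J - ι A) + (ι A - 1ℚ))
      (trans (solve 6 (λ a j b U k i → a :* j :+ (k :* (b :* U :+ i :- a) :+ (a :- con 1ℚ))
            := b :* k :* U :+ ((k :* i :- con 1ℚ) :+ a :* (con 1ℚ :+ j :- k))) refl (ι A) (ι J) (ι B) U (ι (suc J)) (inv J))
        (trans (cong₂ (λ y z → ι B * ι (suc J) * U + ((y - 1ℚ) + ι A * (z - ι (suc J)))) (ι-inv J) (sym (ι-suc J)))
          (solve 3 (λ e a k → e :+ ((con 1ℚ :- con 1ℚ) :+ a :* (k :- k)) := e) refl (ι B * ι (suc J) * U) (ι A) (ι (suc J)))))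
      (0≤+ (0≤* (0≤ι (suc J)) (0≤- hyp)) (0≤- (ι-mono {1} {A} (ℕ.s≤s ℕ.z≤n))))

    lhs≤rhs : lhs ℕ.≤ rhs
    lhs≤rhs = ι-cancel-≤ (begin
      ι lhs                              ≡⟨ trans (ι-* A (J ℕ.* D ℕ.^ N)) (cong (ι A *_) (trans (ι-* J (D ℕ.^ N)) (cong (ι J *_) (ι-^ D N)))) ⟩
      ι A * (ι J * ι D ^ N)              ≡⟨ *-assoc (ι A) (ι J) (ι D ^ N) ⟨
      ι A * ι J * ι D ^ N                ≤⟨ *-monoʳ (0≤^ N (0≤ι D)) scaled ⟩
      ι B * ι (suc J) * U * ι D ^ N      ≡⟨ solve 4 (λ b j u d → b :* j :* u :* d := b :* (j :* (d :* u))) refl (ι B) (ι (suc J)) U (ι D ^ N) ⟩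
      ι B * (ι (suc J) * (ι D ^ N * U))  ≡⟨ cong (λ z → ι B * (ι (suc J) * z)) (trans (cong (_^ N) C≡Du) (^-distrib-* (ι D) u N)) ⟨
      ι B * (ι (suc J) * ι C ^ N)        ≡⟨ trans (ι-* B (suc J ℕ.* C ℕ.^ N)) (cong (ι B *_) (trans (ι-* (suc J) (C ℕ.^ N)) (cong (ι (suc J) *_) (ι-^ C N)))) ⟨
      ι rhs                              ∎)
      where open ≤-Reasoning

    tangent-C : ∀ k → L C k - L D k ≤ u - 1ℚ
    tangent-C k = ι*-cancel d (≤-trans (L-tangent C D k) (≤-reflexive
      (trans (cong (_- ι D) C≡Du) (solve 2 (λ D u → D :* u :- D := D :* (u :- con 1ℚ)) refl (ι D) u))))

    -- The logarithm of that factor is at most 1/J, which is the `inv j` of the conclusion.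
    tangent-J : ∀ k → L (suc J) k - L J k ≤ inv j
    tangent-J k = ι*-cancel j (≤-trans (L-tangent (suc J) J k) (≤-reflexive
      (trans (cong (_- ι J) (ι-suc J)) (trans (solve 1 (λ J → con 1ℚ :+ J :- J := con 1ℚ) refl (ι J)) (sym (ι-inv j))))))

    rest : ℕ → ℚ
    rest k = ι N * (u - 1ℚ - (L C k - L D k)) + (inv j - (L (suc J) k - L J k)) + (L rhs k - L lhs k)

    nonneg : ∀ k → 0ℚ ≤ rest k
    nonneg k = 0≤+ (0≤+ (0≤* (0≤ι N) (0≤- (tangent-C k))) (0≤- (tangent-J k))) (0≤- (L-mono lhs≤rhs k))

    pointwise : ∀ k → rest k + (- (L rhs k - (L B k + (L (suc J) k + ι N * L C k))) + (L lhs k - (L A k + (L J k + ι N * L D k))))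
      ≡ ι N * (u - 1ℚ) + inv j - logSeq A B k
    pointwise k = trans
      (solve 11 (λ n u c d i p q r l a b → (n :* (u :- con 1ℚ :- (c :- d)) :+ (i :- (p :- q)) :+ (r :- l))
          :+ (:- (r :- (b :+ (p :+ n :* c))) :+ (l :- (a :+ (q :+ n :* d)))) := n :* (u :- con 1ℚ) :+ i :- (a :- b)) refl
        (ι N) u (L C k) (L D k) (inv j) (L (suc J) k) (L J k) (L rhs k) (L lhs k) (L A k) (L B k))
      (cong (λ z → ι N * (u - 1ℚ) + inv j - z) (sym (logSeq≡L-L A B k)))

  -- With u = 1 + yₙ/(n+1), the n-th approximant of `exp y` is u^(n+1), and (n+1)(u - 1) = yₙ
  -- exactly. So `log≲power` applies at each fixed large n.
  ≤exp⇒log≲ : ∀ a b y → fromℚ (ι (suc a)) ≤ℝ ι (suc b) · exp y → 0≲ λ n → seq y n - logSeq (suc a) (suc b) n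
  witness (≤exp⇒log≲ a b y a≤b·exp) ε 0<ε = N₁ ℕ.⊔ (N₂ ℕ.⊔ (N₃ ℕ.⊔ suc B)) , λ n n≥ →
    let n≥₁ = ℕ.≤-trans (ℕ.m≤m⊔n N₁ _) n≥
        n≥′ = ℕ.≤-trans (ℕ.m≤n⊔m N₁ _) n≥
        n≥₂ = ℕ.≤-trans (ℕ.m≤m⊔n N₂ _) n≥′
        n≥″ = ℕ.≤-trans (ℕ.m≤n⊔m N₂ _) n≥′
        n≥₃ = ℕ.≤-trans (ℕ.m≤m⊔n N₃ _) n≥″
        n>B = ℕ.≤-trans (ℕ.m≤n⊔m N₃ _) n≥″
        u = 1ℚ + inv n * seq y n
        -- The threshold `K` varies with `n`, so the logarithm cannot be read at index `n` directly.
        -- It is read at a later index `k`, and the Cauchy property of `l` leads back to `n`.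
        K , large = witness (log≲power a b j n u (0<u n n≥₂ n>B) (proj₂ window n n≥₁)) η 0<η
        k = N₃ ℕ.⊔ K
    in subst (0ℚ ≤_) (close n k) (0≤+ (0≤+ (large k (ℕ.m≤n⊔m N₃ K))
         (0≤- (proj₂ near n k n≥₃ (ℕ.m≤m⊔n N₃ K)))) (0≤+ (0≤- (proj₂ small)) (<⇒≤ 0<η)))
    where
    open +-*-Solver
    l = logSeq (suc a) (suc b)
    -- A quarter of ε each for the tolerance in `large`, for `l n - l k` and for `inv j`; the last
    -- quarter completes ε.
    η = ½ * (½ * ε)
    0<η = 0<half (0<half 0<ε)
    small = inv-small η 0<η
    j = proj₁ small
    near = cauchy⇒oneSided l (logSeq-cauchy a b) η 0<η
    N₃ = proj₁ near
    window = a≤b·exp (inv (suc j)) (0<inv (suc j))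
    N₁ = proj₁ window
    bounds = cauchy-bounded (seq y) (cauchy y)
    B = proj₁ bounds
    N₂ = proj₁ (proj₂ bounds)
    -- Here u = (n + 1 + yₙ)/(n+1), and yₙ ≥ -(B+1) ≥ -n gives u ≥ 1/(n+1).
    0<u : ∀ n → N₂ ℕ.≤ n → suc B ℕ.≤ n → 0ℚ < 1ℚ + inv n * seq y n
    0<u n n≥ n>B = <-≤-trans (0<inv n) (≤-by (inv n * ((ι n - ι (suc B)) + (ι (suc B) + seq y n)))
      (trans (solve 4 (λ i n b y → i :+ i :* ((n :- b) :+ (b :+ y)) := (con 1ℚ :+ n) :* i :+ i :* y) refl (inv n) (ι n) (ι (suc B)) (seq y n))
        (cong (_+ inv n * seq y n) (trans (cong (_* inv n) (sym (ι-suc n))) (ι-inv n))))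
      (0≤* (0≤inv n) (0≤+ (0≤- (ι-mono n>B)) (proj₂ (proj₂ (proj₂ bounds) n n≥)))))
    close : ∀ n k → ι (suc n) * (1ℚ + inv n * seq y n - 1ℚ) + inv j - l k + η + (η - (l n - l k)) + ((η - inv j) + η)
      ≡ seq y n - l n + ε
    close n k = trans (solve 7 (λ N i y j e p q → N :* (con 1ℚ :+ i :* y :- con 1ℚ) :+ j :- q :+ e :+ (e :- (p :- q)) :+ ((e :- j) :+ e)
        := (N :* i) :* y :- p :+ ((e :+ e) :+ (e :+ e))) refl (ι (suc n)) (inv n) (seq y n) (inv j) η (l n) (l k))
      (trans (cong₂ (λ p q → p * seq y n - l n + (q + q)) (ι-inv n) (half (½ * ε)))
        (cong₂ (λ p q → p - l n + q) (*-identityˡ (seq y n)) (half ε)))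

  -- How the entropy varies with the exponent of the new prime.

  -- The two-term case of the log sum inequality (Gibbs' inequality for the
  -- weights x/(A+x) and A/(A+x) against y/(A+y) and A/(A+y)), with A = a + 1.
  log-sum : ∀ a x y .{{_ : ℕ.NonZero x}} .{{_ : ℕ.NonZero y}} →
    0≲ λ n → L (suc a ℕ.+ y) n - L (suc a ℕ.+ x) n - inv (a ℕ.+ x) * (ι x * (L y n - L x n))
  log-sum a x y = 0≲-cong pointwise
    (0≲-+ (0≲-* w (0≤inv (a ℕ.+ x)) (0≲-pos nonneg))
      (Null.lower (Null-* (w * ι x) (Null-+ (L-* y X) (Null-neg (L-* x Y))))))
    where
    open +-*-Solver
    w = inv (a ℕ.+ x)
    A = suc a
    X = A ℕ.+ x
    Y = A ℕ.+ y
    P = y ℕ.* X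
    Q = x ℕ.* Y
    -- A + x times the relative entropy of the two weight pairs: P/Q is the ratio of y/Y to x/X, and
    -- X/Y that of A/Y to A/X.
    gap : ℕ → ℚ
    gap n = - (ι x * (L P n - L Q n) + ι A * (L X n - L Y n))
    -- After multiplication by Y, the two tangent bounds are P - Q and A(X - Y), and these add up to
    -- 0.
    nonneg : ∀ n → 0ℚ ≤ gap n
    nonneg n = ι*-cancel (a ℕ.+ y) (subst₂ _≤_ (sym (*-zeroʳ (ι Y))) eq
      (0≤+ (0≤- (L-tangent P Q n)) (0≤* (0≤ι A) (0≤- (L-tangent X Y n)))))
      where
      eq : (ι P - ι Q - ι Q * (L P n - L Q n)) + ι A * (ι X - ι Y - ι Y * (L X n - L Y n)) ≡ ι Y * gap n
      eq = begin
        (ι P - ι Q - ι Q * (L P n - L Q n)) + ι A * (ι X - ι Y - ι Y * (L X n - L Y n))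
          ≡⟨ cong₂ (λ p q → (p - q - q * (L P n - L Q n)) + ι A * (ι X - ι Y - ι Y * (L X n - L Y n))) (ι-* y X) (ι-* x Y) ⟩
        (ι y * ι X - ι x * ι Y - ι x * ι Y * (L P n - L Q n)) + ι A * (ι X - ι Y - ι Y * (L X n - L Y n))
          ≡⟨ cong₂ (λ p q → (ι y * p - ι x * q - ι x * q * (L P n - L Q n)) + ι A * (p - q - q * (L X n - L Y n))) (ι-+ A x) (ι-+ A y) ⟩
        (ι y * (ι A + ι x) - ι x * (ι A + ι y) - ι x * (ι A + ι y) * (L P n - L Q n)) + ι A * ((ι A + ι x) - (ι A + ι y) - (ι A + ι y) * (L X n - L Y n))
          ≡⟨ solve 5 (λ a x y p q → (y :* (a :+ x) :- x :* (a :+ y) :- x :* (a :+ y) :* p) :+ a :* ((a :+ x) :- (a :+ y) :- (a :+ y) :* q)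
               := (a :+ y) :* :- (x :* p :+ a :* q)) refl (ι A) (ι x) (ι y) (L P n - L Q n) (L X n - L Y n) ⟩
        (ι A + ι y) * gap n
          ≡⟨ cong (_* gap n) (ι-+ A y) ⟨
        ι Y * gap n ∎
        where open ≡-Reasoning
    pointwise : ∀ n → w * gap n + w * ι x * (L P n - (L y n + L X n) + - (L Q n - (L x n + L Y n)))
      ≡ L Y n - L X n - w * (ι x * (L y n - L x n))
    pointwise n = trans
      (solve 9 (λ w a x p q X Y lx ly → w :* :- (x :* (p :- q) :+ a :* (X :- Y)) :+ w :* x :* (p :- (ly :+ X) :+ :- (q :- (lx :+ Y)))
          := (a :+ x) :* w :* (Y :- X) :- w :* (x :* (ly :- lx))) refl
        w (ι A) (ι x) (L P n) (L Q n) (L X n) (L Y n) (L x n) (L y n))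
      (cong (_- w * (ι x * (L y n - L x n))) (trans
        (cong (_* (L Y n - L X n)) (trans (cong (_* w) (sym (ι-+ A x))) (ι-inv (a ℕ.+ x))))
        (*-identityˡ (L Y n - L X n))))

  -- The entropy of a number with exponents of sum a + 1 and Σ e log e = C,
  -- after a new prime of exponent x is adjoined.
  G : ℕ → (ℕ → ℚ) → ℕ → ℕ → ℚ
  G a C x n = L (suc a ℕ.+ x) n - inv (a ℕ.+ x) * (ι x * L x n + C n)

  module _ (a : ℕ) (C : ℕ → ℚ) (x y : ℕ) .{{_ : ℕ.NonZero x}} .{{_ : ℕ.NonZero y}} where
    private
      A = suc a
      w = inv (a ℕ.+ x)
      v = inv (a ℕ.+ y)

      E : ℕ → ℚ
      E n = C n - ι A * L y n

      T : ℕ → ℚ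
      T n = L (A ℕ.+ y) n - L (A ℕ.+ x) n - w * (ι x * (L y n - L x n))

      weight : ∀ z → (ι A + ι z) * inv (a ℕ.+ z) ≡ 1ℚ
      weight z = trans (cong (_* inv (a ℕ.+ z)) (sym (ι-+ A z))) (ι-inv (a ℕ.+ z))

      -- Exact at every index: the two sides differ by the multiple (A + x)w - (A + y)v of log y,
      -- and both products are 1.
      pointwise : ∀ n → T n + (w - v) * E n ≡ G a C y n - G a C x n
      pointwise n = sym (trans
        (solve 10 (λ w v a x y X Y lx ly c →
          (Y :- v :* (y :* ly :+ c)) :- (X :- w :* (x :* lx :+ c))
          := (Y :- X :- w :* (x :* (ly :- lx))) :+ (w :- v) :* (c :- a :* ly) :+ ((a :+ x) :* w :- (a :+ y) :* v) :* ly) refl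
          w v (ι A) (ι x) (ι y) (L (A ℕ.+ x) n) (L (A ℕ.+ y) n) (L x n) (L y n) (C n))
        (trans (cong₂ (λ p q → T n + (w - v) * E n + (p - q) * L y n) (weight x) (weight y))
          (solve 2 (λ t l → t :+ (con 1ℚ :- con 1ℚ) :* l := t) refl (T n + (w - v) * E n) (L y n))))
        where open +-*-Solver

    G-increasing : x ℕ.≤ y → 0≲ E → 0≲ λ n → G a C y n - G a C x n
    G-increasing x≤y 0≲E = 0≲-cong pointwise (0≲-+ (log-sum a x y)
      (0≲-* (w - v) (0≤- (inv-antimono (ℕ.+-monoʳ-≤ a x≤y))) 0≲E))

    G-decreasing : y ℕ.≤ x → 0≲ (λ n → - E n) → 0≲ λ n → G a C y n - G a C x n
    G-decreasing y≤x E≲0 = 0≲-cong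
      (λ n → trans (cong (T n +_) (solve 3 (λ w v e → (v :- w) :* :- e := (w :- v) :* e) refl w v (E n))) (pointwise n))
      (0≲-+ (log-sum a x y) (0≲-* (v - w) (0≤- (inv-antimono (ℕ.+-monoʳ-≤ a y≤x))) E≲0))
      where open +-*-Solver

  -- Separating the total from the exponents in an entropy sum.

  ΣeL : (ℕ → ℕ) → List ℕ → ℕ → ℚ
  ΣeL f ds n = foldr _+_ 0ℚ (map (λ q → ι (f q) * L (f q) n) ds)

  -- The denominator `suc s` is kept independent of the sum of the exponents, so that it stays fixed
  -- while the induction shortens the list.
  weighted-log-sum : ∀ f s ds → All (λ q → 1 ℕ.≤ f q) ds →
    Null λ n → seq (sumℝ (map (λ q → (f q ÷ℕ suc s) · log (f q ÷ℕ suc s)) ds)) n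
             - inv s * (ΣeL f ds n - ι (sum (map f ds)) * L (suc s) n)
  weighted-log-sum f s []       []         = Null-0 λ n →
    solve 2 (λ i l → con 0ℚ :- i :* (con 0ℚ :- con 0ℚ :* l) := con 0ℚ) refl (inv s) (L (suc s) n)
    where open +-*-Solver
  weighted-log-sum f s (q ∷ ds) (1≤fq ∷ 1≤f) = Null-cong pointwise
    (Null-+ (Null-* (f q ÷ℕ suc s) (log-term (f q) 1≤fq)) (weighted-log-sum f s ds 1≤f))
    where
    open +-*-Solver
    log-term : ∀ e → 1 ℕ.≤ e → Null λ n → seq (log (e ÷ℕ suc s)) n - (L e n - L (suc s) n)
    log-term (suc e) _ = log-÷ e s
    r = λ n → seq (sumℝ (map (λ q → (f q ÷ℕ suc s) · log (f q ÷ℕ suc s)) ds)) n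
    pointwise : ∀ n → (f q ÷ℕ suc s) * (seq (log (f q ÷ℕ suc s)) n - (L (f q) n - L (suc s) n))
        + (r n - inv s * (ΣeL f ds n - ι (sum (map f ds)) * L (suc s) n))
      ≡ (f q ÷ℕ suc s) * seq (log (f q ÷ℕ suc s)) n + r n
        - inv s * (ι (f q) * L (f q) n + ΣeL f ds n - ι (f q ℕ.+ sum (map f ds)) * L (suc s) n)
    pointwise n = begin
      Q * (g - (l - S)) + (r n - i * (Z - σ * S))
        ≡⟨ cong (λ z → z * (g - (l - S)) + (r n - i * (Z - σ * S))) (÷ℕ≡*inv (f q) s) ⟩
      ι (f q) * i * (g - (l - S)) + (r n - i * (Z - σ * S))
        ≡⟨ solve 8 (λ e i g l S r Z σ → e :* i :* (g :- (l :- S)) :+ (r :- i :* (Z :- σ :* S))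
             := e :* i :* g :+ r :- i :* (e :* l :+ Z :- (e :+ σ) :* S)) refl (ι (f q)) i g l S (r n) Z σ ⟩
      ι (f q) * i * g + r n - i * (ι (f q) * l + Z - (ι (f q) + σ) * S)
        ≡⟨ cong₂ (λ z t → z * g + r n - i * (ι (f q) * l + Z - t * S)) (÷ℕ≡*inv (f q) s) (ι-+ (f q) (sum (map f ds))) ⟨
      Q * g + r n - i * (ι (f q) * l + Z - ι (f q ℕ.+ sum (map f ds)) * S) ∎
      where
      open ≡-Reasoning
      Q = f q ÷ℕ suc s
      g = seq (log Q) n
      l = L (f q) n
      S = L (suc s) n
      i = inv s
      Z = ΣeL f ds n
      σ = ι (sum (map f ds))

-- Prime factorisations as lists up to permutation.

module Factorisation where

  open import Data.Bool.Base using (true; false)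
  open import Data.List.Base using (List; []; _∷_; _++_; concatMap; filter; length; map; replicate)
  open import Data.List.Membership.Propositional using (_∈_)
  open import Data.List.Membership.Propositional.Properties
    using (∈-++⁺ˡ; ∈-++⁺ʳ; ∈-++⁻; ∈-deduplicate⁺; ∈-deduplicate⁻; ∈-filter⁺; ∈-filter⁻; ∈-length; ∈-map⁺)
  open import Data.List.Membership.Propositional.Properties.WithK using (unique∧set⇒bag)
  open import Data.List.Properties
    using (filter-++; filter-accept; filter-reject; filter-all; filter-none; length-++; length-replicate; map-cong-local)
  open import Data.List.Relation.Binary.BagAndSetEquality using (∼bag⇒↭)
  open import Data.List.Relation.Binary.Permutation.Propositional using (_↭_; prep; ↭-refl; ↭-sym; ↭-trans; ↭-reflexive)
  open import Data.List.Relation.Binary.Permutation.Propositional.Properties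
    using (∈-resp-↭; filter-↭; shift; ↭-length; ++⁺ˡ) renaming (map⁺ to ↭-map⁺)
  open import Data.List.Relation.Unary.All as All using (All; []; _∷_)
  open import Data.List.Relation.Unary.All.Properties using (all-filter; replicate⁺; ¬Any⇒All¬) renaming (++⁺ to All-++⁺)
  open import Data.List.Relation.Unary.Any using (here; there)
  open import Data.List.Relation.Unary.Unique.Propositional using (Unique; []; _∷_)
  open import Data.List.Relation.Unary.Unique.DecPropositional.Properties using (deduplicate-!)
  open import Data.Nat.Base using (NonZero; _+_; _*_; _^_; _≤_; _<_; s≤s; z≤n)
  open import Data.Nat.Divisibility using (_∣_; ∣-trans; ∣-reflexive; m∣m*n; ∣1⇒≡1; *-monoʳ-∣; ∣⇒≤)
  open import Data.Nat.ListAction using (sum; product)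
  open import Data.Nat.ListAction.Properties using (product-++; product-↭; ∈⇒∣product)
  open import Data.Nat.Primality using (Prime; prime⇒nonZero; ¬prime[1])
  open import Data.Nat.Primality.Factorisation using (module PrimeFactorisation; factorise; factorisationUnique)
  open import Data.Nat.Properties
    using (_≟_; m*n≢0; m^n≢0; *-comm; *-identityʳ; ≤-antisym; ≮⇒≥; +-identityʳ)
  open import Data.Sum.Base using (inj₁; inj₂)
  open import Function.Base using (_∘_)
  open import Function.Bundles using (mk⇔)
  open import Relation.Binary.PropositionalEquality using (_≢_)
  open import Relation.Nullary using (¬_; yes; no; ¬?; contradiction; does)
  open import Relation.Unary using (Decidable)
  open PrimeFactorisation

  filter-split : ∀ {A : Set} {P : A → Set} (P? : Decidable P) xs → filter P? xs ++ filter (¬? ∘ P?) xs ↭ xs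
  filter-split P? []       = ↭-refl
  filter-split P? (x ∷ xs) with does (P? x)
  ... | true  = prep x (filter-split P? xs)
  ... | false = ↭-trans (shift x (filter P? xs) _) (prep x (filter-split P? xs))

  filter-⊆ : ∀ {A : Set} {P Q : A → Set} (P? : Decidable P) (Q? : Decidable Q) → (∀ {x} → Q x → P x) →
    ∀ xs → filter Q? (filter P? xs) ≡ filter Q? xs
  filter-⊆ P? Q? Q⇒P []       = refl
  filter-⊆ P? Q? Q⇒P (x ∷ xs) with P? x | Q? x
  ... | yes _  | yes Qx = trans (filter-accept Q? Qx) (cong (x ∷_) (filter-⊆ P? Q? Q⇒P xs))
  ... | yes _  | no ¬Qx = trans (filter-reject Q? ¬Qx) (filter-⊆ P? Q? Q⇒P xs)
  ... | no ¬Px | yes Qx = contradiction (Q⇒P Qx) ¬Px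
  ... | no _   | no _   = filter-⊆ P? Q? Q⇒P xs

  concatMap-cong-local : ∀ {f g : ℕ → List ℕ} {ds} → All (λ q → f q ≡ g q) ds → concatMap f ds ≡ concatMap g ds
  concatMap-cong-local []         = refl
  concatMap-cong-local (eq ∷ eqs) = cong₂ _++_ eq (concatMap-cong-local eqs)

  -- The induction is on `ds`: deleting all copies of its head from `xs` leaves the classes of the
  -- other entries unchanged, because they differ from the head.
  group-↭ : ∀ {ds} → Unique ds → ∀ xs → (∀ {q} → q ∈ xs → q ∈ ds) → concatMap (λ q → filter (q ≟_) xs) ds ↭ xs
  group-↭ []                     []       xs⊆ds = ↭-refl
  group-↭ []                     (x ∷ xs) xs⊆ds = contradiction (xs⊆ds (here refl)) λ ()
  group-↭ {d ∷ ds} (d∉ds ∷ uniq) xs       xs⊆ds = ↭-trans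
    (++⁺ˡ (filter (d ≟_) xs) (↭-trans
      (↭-reflexive (concatMap-cong-local (All.map (λ d≢q → sym (filter-⊆ (¬? ∘ (d ≟_)) (_ ≟_) (λ { refl d≡q → d≢q d≡q }) xs)) d∉ds)))
      (group-↭ uniq (filter (¬? ∘ (d ≟_)) xs) ys⊆ds)))
    (filter-split (d ≟_) xs)
    where
    ys⊆ds : ∀ {q} → q ∈ filter (¬? ∘ (d ≟_)) xs → q ∈ ds
    ys⊆ds q∈ys with ∈-filter⁻ (¬? ∘ (d ≟_)) {xs = xs} q∈ys
    ... | q∈xs , d≢q with xs⊆ds q∈xs
    ...   | here q≡d   = contradiction (sym q≡d) d≢q
    ...   | there q∈ds = q∈ds

  length-concatMap : ∀ (f : ℕ → List ℕ) ds → length (concatMap f ds) ≡ sum (map (length ∘ f) ds)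
  length-concatMap f []       = refl
  length-concatMap f (d ∷ ds) = trans (length-++ (f d)) (cong (length (f d) +_) (length-concatMap f ds))

  product-concatMap : ∀ (f : ℕ → List ℕ) ds → product (concatMap f ds) ≡ product (map (product ∘ f) ds)
  product-concatMap f []       = refl
  product-concatMap f (d ∷ ds) = trans (product-++ (f d) (concatMap f ds)) (cong (product (f d) *_) (product-concatMap f ds))

  product-constant : ∀ {q xs} → All (q ≡_) xs → product xs ≡ q ^ length xs
  product-constant []            = refl
  product-constant {q} (refl ∷ q≡xs) = cong (q *_) (product-constant q≡xs)

  primeFactors-prime : ∀ N → All Prime (primeFactors N)
  primeFactors-prime zero      = []
  primeFactors-prime N@(suc _) = factorsPrime (factorise N)

  product-primeFactors : ∀ N .{{_ : NonZero N}} → product (primeFactors N) ≡ N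
  product-primeFactors N@(suc _) = sym (isFactorisation (factorise N))

  primeFactors-unique : ∀ N .{{_ : NonZero N}} {ps} → N ≡ product ps → All Prime ps → primeFactors N ↭ ps
  primeFactors-unique N@(suc _) N≡Πps primes = factorisationUnique (factorise N)
    (record { factors = _ ; isFactorisation = N≡Πps ; factorsPrime = primes })

  ∈-primeFactors⇒∣ : ∀ {q} N .{{_ : NonZero N}} → q ∈ primeFactors N → q ∣ N
  ∈-primeFactors⇒∣ N q∈ = ∣-trans (∈⇒∣product q∈) (∣-reflexive (product-primeFactors N))

  -- Taking lengths yields Σ ν = Ω, and taking products yields Π q^ν = N.
  group-primeFactors : ∀ N → concatMap (λ q → filter (q ≟_) (primeFactors N)) (distinctPrimes N) ↭ primeFactors N
  group-primeFactors N = group-↭ (deduplicate-! _≟_ (primeFactors N)) (primeFactors N) (∈-deduplicate⁺ _≟_)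

  Σν≡Ω : ∀ N → sum (map (λ q → ν q N) (distinctPrimes N)) ≡ Ω N
  Σν≡Ω N = trans (sym (length-concatMap (λ q → filter (q ≟_) (primeFactors N)) (distinctPrimes N))) (↭-length (group-primeFactors N))

  Πq^ν≡N : ∀ N .{{_ : NonZero N}} → product (map (λ q → q ^ ν q N) (distinctPrimes N)) ≡ N
  Πq^ν≡N N = begin
    product (map (λ q → q ^ ν q N) (distinctPrimes N))
      ≡⟨ cong product (map-cong-local (All.universal (λ q → product-constant (all-filter (q ≟_) (primeFactors N))) (distinctPrimes N))) ⟨
    product (map (λ q → product (filter (q ≟_) (primeFactors N))) (distinctPrimes N))
      ≡⟨ product-concatMap (λ q → filter (q ≟_) (primeFactors N)) (distinctPrimes N) ⟨
    product (concatMap (λ q → filter (q ≟_) (primeFactors N)) (distinctPrimes N))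
      ≡⟨ product-↭ (group-primeFactors N) ⟩
    product (primeFactors N)
      ≡⟨ product-primeFactors N ⟩
    N ∎
    where open ≡-Reasoning

  ν-positive : ∀ N → All (λ q → 1 ≤ ν q N) (distinctPrimes N)
  ν-positive N = All.tabulate λ {q} q∈ → ∈-length (∈-filter⁺ (q ≟_) (∈-deduplicate⁻ _≟_ (primeFactors N) q∈) refl)

  -- An exponent of at least 2 would make q² divide N and so force the prime q to be 1.
  squareFree⇒ν≡1 : ∀ N .{{_ : NonZero N}} → SquareFree N → All (λ q → ν q N ≡ 1) (distinctPrimes N)
  squareFree⇒ν≡1 N sf = All.tabulate λ {q} q∈ → ≤-antisym (≮⇒≥ λ 1<ν → not-one q∈ (sf q (square∣N q∈ 1<ν))) (All.lookup (ν-positive N) q∈)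
    where
    not-one : ∀ {q} → q ∈ distinctPrimes N → q ≢ 1
    not-one q∈ refl = ¬prime[1] (All.lookup (primeFactors-prime N) (∈-deduplicate⁻ _≟_ (primeFactors N) q∈))
    square∣power : ∀ q {k} → 1 < k → q * q ∣ q ^ k
    square∣power q {suc (suc k)} _ = *-monoʳ-∣ q (m∣m*n (q ^ k))
    square∣power q {suc zero} (s≤s ())
    square∣N : ∀ {q} → q ∈ distinctPrimes N → 1 < ν q N → q * q ∣ N
    square∣N {q} q∈ 1<ν = ∣-trans (square∣power q 1<ν)
      (∣-trans (∈⇒∣product (∈-map⁺ (λ q → q ^ ν q N) q∈)) (∣-reflexive (Πq^ν≡N N)))

  Ω-positive : ∀ {N} → 2 ≤ N → ∃[ a ] Ω N ≡ suc a
  Ω-positive {N@(suc (suc _))} (s≤s (s≤s _)) with primeFactors N | product-primeFactors N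
  ... | []     | ()
  ... | _ ∷ ps | _ = length ps , refl

  -- Adjoining a power of a new prime, and its exponential divisors.

  module _ (n p : ℕ) .{{_ : NonZero n}} (p-prime : Prime p) (p∤n : ¬ p ∣ n) where
    private instance
      p≢0 : NonZero p
      p≢0 = prime⇒nonZero p-prime

    product-replicate : ∀ x → product (replicate x p) ≡ p ^ x
    product-replicate zero    = refl
    product-replicate (suc x) = cong (p *_) (product-replicate x)

    primeFactors-adjoin : ∀ x → primeFactors (n * p ^ x) ↭ primeFactors n ++ replicate x p
    primeFactors-adjoin x = primeFactors-unique (n * p ^ x)
      (sym (trans (product-++ (primeFactors n) (replicate x p)) (cong₂ _*_ (product-primeFactors n) (product-replicate x))))
      (All-++⁺ (primeFactors-prime n) (replicate⁺ x p-prime))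
      where instance
      p^x≢0 : NonZero (p ^ x)
      p^x≢0 = m^n≢0 p x
      n*p^x≢0 : NonZero (n * p ^ x)
      n*p^x≢0 = m*n≢0 n (p ^ x)

    Ω-adjoin : ∀ x → Ω (n * p ^ x) ≡ Ω n + x
    Ω-adjoin x = trans (↭-length (primeFactors-adjoin x))
      (trans (length-++ (primeFactors n)) (cong (Ω n +_) (length-replicate x)))

    ν-adjoin : ∀ q x → ν q (n * p ^ x) ≡ ν q n + length (filter (q ≟_) (replicate x p))
    ν-adjoin q x = trans (↭-length (filter-↭ (q ≟_) (primeFactors-adjoin x)))
      (trans (cong length (filter-++ (q ≟_) (primeFactors n) (replicate x p))) (length-++ (filter (q ≟_) (primeFactors n))))

    p∉primeFactors : ¬ p ∈ primeFactors n
    p∉primeFactors = p∤n ∘ ∈-primeFactors⇒∣ n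

    ν-adjoin-new : ∀ x → ν p (n * p ^ x) ≡ x
    ν-adjoin-new x = trans (ν-adjoin p x) (cong₂ _+_
      (cong length (filter-none (p ≟_) (¬Any⇒All¬ (primeFactors n) p∉primeFactors)))
      (trans (cong length (filter-all (p ≟_) (replicate⁺ x refl))) (length-replicate x)))

    ν-adjoin-old : ∀ x → All (λ q → ν q (n * p ^ x) ≡ ν q n) (distinctPrimes n)
    ν-adjoin-old x = All.tabulate λ {q} q∈ → trans (ν-adjoin q x)
      (trans (cong (λ xs → ν q n + length xs) (filter-none (q ≟_) (replicate⁺ x λ { refl → p∉primeFactors (∈-deduplicate⁻ _≟_ (primeFactors n) q∈) })))
        (+-identityʳ (ν q n)))

    -- Both lists are free of duplicates, so equal membership already makes them permutations of
    -- each other.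
    distinctPrimes-adjoin : ∀ x .{{_ : NonZero x}} → distinctPrimes (n * p ^ x) ↭ p ∷ distinctPrimes n
    distinctPrimes-adjoin x@(suc _) = ∼bag⇒↭ (unique∧set⇒bag
      (deduplicate-! _≟_ (primeFactors (n * p ^ x)))
      (¬Any⇒All¬ (distinctPrimes n) (p∉primeFactors ∘ ∈-deduplicate⁻ _≟_ (primeFactors n)) ∷ deduplicate-! _≟_ (primeFactors n))
      (mk⇔ to from))
      where
      to : ∀ {q} → q ∈ distinctPrimes (n * p ^ x) → q ∈ p ∷ distinctPrimes n
      to q∈ with ∈-++⁻ (primeFactors n) (∈-resp-↭ (primeFactors-adjoin x) (∈-deduplicate⁻ _≟_ (primeFactors (n * p ^ x)) q∈))
      ... | inj₁ q∈n = there (∈-deduplicate⁺ _≟_ q∈n)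
      ... | inj₂ q∈p = here (sym (All.lookup (replicate⁺ {P = p ≡_} x refl) q∈p))
      from : ∀ {q} → q ∈ p ∷ distinctPrimes n → q ∈ distinctPrimes (n * p ^ x)
      from (here refl) = ∈-deduplicate⁺ _≟_ (∈-resp-↭ (↭-sym (primeFactors-adjoin x)) (∈-++⁺ʳ (primeFactors n) (here refl)))
      from (there q∈)  = ∈-deduplicate⁺ _≟_ (∈-resp-↭ (↭-sym (primeFactors-adjoin x)) (∈-++⁺ˡ (∈-deduplicate⁻ _≟_ (primeFactors n) q∈)))

    new∈distinctPrimes : ∀ x .{{_ : NonZero x}} → p ∈ distinctPrimes (n * p ^ x)
    new∈distinctPrimes x = ∈-resp-↭ (↭-sym (distinctPrimes-adjoin x)) (here refl)

    product-adjoin : ∀ x .{{_ : NonZero x}} (f : ℕ → ℕ) →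
      product (map f (distinctPrimes (n * p ^ x))) ≡ f p * product (map f (distinctPrimes n))
    product-adjoin x f = product-↭ (↭-map⁺ f (distinctPrimes-adjoin x))

    -- At the primes of n the exponent divides 1, so only the exponent of p is free. It divides x,
    -- whence the bound.
    exponentialDivisor-squareFree : SquareFree n → ∀ x .{{_ : NonZero x}} {d} → ExponentialDivisor d (n * p ^ x) →
      ∃[ y ] 1 ≤ y × y ≤ x × d ≡ n * p ^ y
    exponentialDivisor-squareFree sf x {d} (β , β-exponents , d≡) = β p , proj₁ βp , ∣⇒≤ y∣x , (begin
      d                                                                ≡⟨ d≡ ⟩
      product (map (λ q → q ^ β q) (distinctPrimes (n * p ^ x)))       ≡⟨ product-adjoin x (λ q → q ^ β q) ⟩
      p ^ β p * product (map (λ q → q ^ β q) (distinctPrimes n))       ≡⟨ cong (λ z → p ^ β p * product z) (map-cong-local βq≡ν) ⟩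
      p ^ β p * product (map (λ q → q ^ ν q n) (distinctPrimes n))     ≡⟨ cong (p ^ β p *_) (Πq^ν≡N n) ⟩
      p ^ β p * n                                                      ≡⟨ *-comm (p ^ β p) n ⟩
      n * p ^ β p                                                      ∎)
      where
      open ≡-Reasoning
      βp = β-exponents p (new∈distinctPrimes x)
      y∣x : β p ∣ x
      y∣x = subst (β p ∣_) (ν-adjoin-new x) (proj₂ βp)
      βq≡ν : All (λ q → q ^ β q ≡ q ^ ν q n) (distinctPrimes n)
      βq≡ν = All.tabulate λ {q} q∈ →
        let ν≡1 = All.lookup (squareFree⇒ν≡1 n sf) q∈
            β∣ν = proj₂ (β-exponents q (∈-resp-↭ (↭-sym (distinctPrimes-adjoin x)) (there q∈)))
        in cong (q ^_) (trans (∣1⇒≡1 (subst (β q ∣_) (trans (All.lookup (ν-adjoin-old x) q∈) ν≡1) β∣ν)) (sym ν≡1))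

    -- Exponent 0 would give d = n, but p divides every exponential divisor of n p^x and does not
    -- divide n.
    exponentialDivisor-exponent : ∀ x .{{_ : NonZero x}} {d} y → ExponentialDivisor d (n * p ^ x) → d ≡ n * p ^ y → NonZero y
    exponentialDivisor-exponent x (suc y) _ _ = _
    exponentialDivisor-exponent x {d} zero (β , β-exponents , d≡) d≡n = contradiction
      (subst (p ∣_) (trans d≡n (*-identityʳ n)) p∣d) p∤n
      where
      p∣power : ∀ {k} → 1 ≤ k → p ∣ p ^ k
      p∣power {suc k} _ = m∣m*n (p ^ k)
      p∣d : p ∣ d
      p∣d = ∣-trans (p∣power (proj₁ (β-exponents p (new∈distinctPrimes x))))
        (∣-trans (∈⇒∣product (∈-map⁺ (λ q → q ^ β q) (new∈distinctPrimes x))) (∣-reflexive (sym d≡)))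

-- The entropy of n p^x in terms of `G`.

module Adjunction where

  open import Data.List.Base using (foldr; map)
  open import Data.List.Properties using (map-cong-local)
  open import Data.List.Relation.Binary.Permutation.Propositional using (_↭_; ↭⇒↭ₛ)
  open import Data.List.Relation.Binary.Permutation.Propositional.Properties using () renaming (map⁺ to ↭-map⁺)
  import Data.List.Relation.Binary.Permutation.Setoid.Properties as PermutationSetoid
  open import Data.List.Relation.Unary.All as All using (All; []; _∷_)
  open import Data.Nat.Base using (NonZero; _+_; _*_; _^_; _≤_; s≤s; z≤n)
  open import Data.Nat.Divisibility using (_∣_)
  open import Data.Nat.ListAction using (sum)
  open import Data.Nat.Primality using (Prime)
  open import Data.Rational.Base as ℚ using (ℚ; 0ℚ; -_; _-_)
  open import Data.Rational.Properties using (*-identityˡ; *-zeroʳ; +-0-isCommutativeMonoid)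
  open import Data.Rational.Solver using (module +-*-Solver)
  open import Relation.Binary.PropositionalEquality using (setoid)
  open import Relation.Nullary using (¬_)
  open Entropy
  open Factorisation
  open +-*-Solver

  -- The reordering takes place in ℚ at a fixed index, where addition is commutative up to `≡`.
  ΣeL-↭ : ∀ f {ds es} → ds ↭ es → ∀ k → ΣeL f ds k ≡ ΣeL f es k
  ΣeL-↭ f ds↭es k = PermutationSetoid.foldr-commMonoid (setoid ℚ) +-0-isCommutativeMonoid
    (↭⇒↭ₛ (↭-map⁺ (λ q → ι (f q) ℚ.* L (f q) k) ds↭es))

  ΣeL-cong : ∀ {f g ds} → All (λ q → f q ≡ g q) ds → ∀ k → ΣeL f ds k ≡ ΣeL g ds k
  ΣeL-cong eqs k = cong (foldr ℚ._+_ 0ℚ) (map-cong-local (All.map (cong λ e → ι e ℚ.* L e k) eqs))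

  ΣeL-1 : ∀ {f ds} → All (λ q → f q ≡ 1) ds → ∀ k → ΣeL f ds k ≡ 0ℚ
  ΣeL-1 []         k = refl
  ΣeL-1 (eq ∷ eqs) k = cong₂ ℚ._+_
    (trans (cong (λ e → ι e ℚ.* L e k) eq) (trans (cong (ι 1 ℚ.*_) (L-1 k)) (*-zeroʳ (ι 1))))
    (ΣeL-1 eqs k)

  -- Since Σ ν = Ω, the coefficient of log Ω in `weighted-log-sum` becomes Ω/Ω = 1.
  entropy≈ : ∀ N s → Ω N ≡ suc s →
    Null λ k → seq (H N) k - (L (suc s) k - inv s ℚ.* ΣeL (λ q → ν q N) (distinctPrimes N) k)
  entropy≈ N s Ω≡ = Null-cong pointwise (Null-neg (weighted-log-sum (λ q → ν q N) s (distinctPrimes N) (ν-positive N)))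
    where
    S : ℕ → ℕ → ℚ
    S ω = seq (sumℝ (map (λ q → (ν q N ÷ℕ ω) · log (ν q N ÷ℕ ω)) (distinctPrimes N)))
    Z = ΣeL (λ q → ν q N) (distinctPrimes N)
    pointwise : ∀ k → - (S (suc s) k - inv s ℚ.* (Z k - ι (sum (map (λ q → ν q N) (distinctPrimes N))) ℚ.* L (suc s) k))
      ≡ - S (Ω N) k - (L (suc s) k - inv s ℚ.* Z k)
    pointwise k = begin
      - (S (suc s) k - inv s ℚ.* (Z k - ι (sum (map (λ q → ν q N) (distinctPrimes N))) ℚ.* l))
        ≡⟨ cong₂ (λ t u → - (S t k - inv s ℚ.* (Z k - ι u ℚ.* l))) (sym Ω≡) (trans (Σν≡Ω N) Ω≡) ⟩
      - (S (Ω N) k - inv s ℚ.* (Z k - ι (suc s) ℚ.* l))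
        ≡⟨ solve 5 (λ S i Z σ l → :- (S :- i :* (Z :- σ :* l)) := :- S :- ((σ :* i) :* l :- i :* Z)) refl (S (Ω N) k) (inv s) (Z k) (ι (suc s)) l ⟩
      - S (Ω N) k - ((ι (suc s) ℚ.* inv s) ℚ.* l - inv s ℚ.* Z k)
        ≡⟨ cong (λ z → - S (Ω N) k - (z - inv s ℚ.* Z k)) (trans (cong (ℚ._* l) (ι-inv s)) (*-identityˡ l)) ⟩
      - S (Ω N) k - (l - inv s ℚ.* Z k) ∎
      where
      open ≡-Reasoning
      l = L (suc s) k

  module _ (n p a : ℕ) .{{_ : NonZero n}} (p-prime : Prime p) (p∤n : ¬ p ∣ n) (Ωn≡ : Ω n ≡ suc a) where
    private
      C : ℕ → ℚ
      C = ΣeL (λ q → ν q n) (distinctPrimes n)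

    ΣeL-adjoin : ∀ x .{{_ : NonZero x}} k →
      ΣeL (λ q → ν q (n * p ^ x)) (distinctPrimes (n * p ^ x)) k ≡ ι x ℚ.* L x k ℚ.+ C k
    ΣeL-adjoin x k = trans (ΣeL-↭ (λ q → ν q (n * p ^ x)) (distinctPrimes-adjoin n p p-prime p∤n x) k) (cong₂ ℚ._+_
      (cong (λ e → ι e ℚ.* L e k) (ν-adjoin-new n p p-prime p∤n x))
      (ΣeL-cong {λ q → ν q (n * p ^ x)} {λ q → ν q n} (ν-adjoin-old n p p-prime p∤n x) k))

    entropy≈G : ∀ x .{{_ : NonZero x}} → Null λ k → seq (H (n * p ^ x)) k - G a C x k
    entropy≈G x = Null-cong
      (λ k → cong (λ z → seq (H (n * p ^ x)) k - (L (suc a + x) k - inv (a + x) ℚ.* z)) (ΣeL-adjoin x k))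
      (entropy≈ (n * p ^ x) (a + x) (trans (Ω-adjoin n p p-prime p∤n x) (cong (_+ x) Ωn≡)))

    G≲G⇒H≤H : ∀ x y .{{_ : NonZero x}} .{{_ : NonZero y}} →
      0≲ (λ k → G a C y k - G a C x k) → H (n * p ^ x) ≤ℝ H (n * p ^ y)
    G≲G⇒H≤H x y Gx≲Gy = 0≲⇒≤ℝ {H (n * p ^ x)} {H (n * p ^ y)} (0≲-cong
      (λ k → solve 4 (λ hx hy gx gy → (hy :- gy) :+ ((gy :- gx) :+ :- (hx :- gx)) := hy :- hx) refl
        (seq (H (n * p ^ x)) k) (seq (H (n * p ^ y)) k) (G a C x k) (G a C y k))
      (0≲-+ (Null.lower (entropy≈G y)) (0≲-+ Gx≲Gy (Null.upper (entropy≈G x)))))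

    entropy-decreasing : SquareFree n → ∀ x y .{{_ : NonZero x}} .{{_ : NonZero y}} →
      y ≤ x → H (n * p ^ x) ≤ℝ H (n * p ^ y)
    -- All exponents of n are 1, so C vanishes at every index; what remains is A log y ≥ 0, from y ≥
    -- 1.
    entropy-decreasing sf x y@(suc y′) y≤x = G≲G⇒H≤H x y (G-decreasing a C x y y≤x (0≲-pos λ k →
      subst (0ℚ ℚ.≤_)
        (trans (solve 2 (λ A l → A :* (l :- con 0ℚ) := :- (con 0ℚ :- A :* l)) refl (ι (suc a)) (L y k))
          (cong (λ z → - (z - ι (suc a) ℚ.* L y k)) (sym (ΣeL-1 {λ q → ν q n} (squareFree⇒ν≡1 n sf) k))))
        (0≤* (0≤ι (suc a)) (0≤- (subst (ℚ._≤ L y k) (L-1 k) (L-mono (s≤s (z≤n {y′})) k))))))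

    -- The hypothesis gives log (y/A) ≤ -H(n). Adding H(n) = log A - C/A from `entropy≈` and
    -- multiplying by A cancels H(n) and leaves A log y ≤ C.
    entropy-increasing : ∀ x y .{{_ : NonZero x}} .{{_ : NonZero y}} →
      x ≤ y → fromℚ (ι y) ≤ℝ ι (Ω n) · exp (-ℝ H n) → H (n * p ^ x) ≤ℝ H (n * p ^ y)
    entropy-increasing x y@(suc y′) x≤y y≤Ωe^-H = G≲G⇒H≤H x y (G-increasing a C x y x≤y (0≲-cong pointwise
      (0≲-* A (0≤ι (suc a)) (0≲-+
        (≤exp⇒log≲ y′ a (-ℝ H n) (subst (λ ω → fromℚ (ι y) ≤ℝ ι ω · exp (-ℝ H n)) Ωn≡ y≤Ωe^-H))
        (Null.lower (entropy≈ n a Ωn≡))))))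
      where
      A = ι (suc a)
      pointwise : ∀ k → A ℚ.* (- seq (H n) k - logSeq y (suc a) k ℚ.+ (seq (H n) k - (L (suc a) k - inv a ℚ.* C k)))
        ≡ C k - A ℚ.* L y k
      pointwise k = trans
        (cong (λ z → A ℚ.* (- seq (H n) k - z ℚ.+ (seq (H n) k - (L (suc a) k - inv a ℚ.* C k)))) (logSeq≡L-L y (suc a) k))
        (trans (solve 6 (λ A h l m i c → A :* (:- h :- (l :- m) :+ (h :- (m :- i :* c))) := (A :* i) :* c :- A :* l) refl
            A (seq (H n) k) (L y k) (L (suc a) k) (inv a) (C k))
          (cong (_- A ℚ.* L y k) (trans (cong (ℚ._* C k) (ι-inv a)) (*-identityˡ (C k)))))

open Factorisation using (Ω-positive; exponentialDivisor-squareFree; exponentialDivisor-exponent)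
open Adjunction
open import Data.Nat.Base using (_≤_; _*_; _^_; NonZero; >-nonZero; s≤s; z≤n)
open import Data.Nat.Divisibility using (_∣_; ∣1⇒≡1; ∣-refl)
open import Data.Nat.GCD using (gcd; gcd-greatest)
open import Data.Nat.Primality using (Prime; ¬prime[1])
open import Data.Nat.Properties using (≤-trans)
open import Relation.Nullary using (¬_)

mainTheorem8 : ∀ (n p α : ℕ) → 2 ≤ n → Prime p → gcd n p ≡ 1 → 1 ≤ α →
    let m = n * p ^ α in
    (SquareFree n → ∀ d → ExponentialDivisor d m → H m ≤ℝ H d)
    × (¬ SquareFree n → ∀ d β → ExponentialDivisor d m → d ≡ n * p ^ β →
    β ≤ α → fromℚ (ι α) ≤ℝ ι (Ω n) · exp (-ℝ H n) → H d ≤ℝ H m)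
mainTheorem8 n p α 2≤n p-prime gcd≡1 1≤α = part₁ , part₂
  where
  instance
    n≢0 : NonZero n
    n≢0 = >-nonZero (≤-trans (s≤s z≤n) 2≤n)
    α≢0 : NonZero α
    α≢0 = >-nonZero 1≤α

  p∤n : ¬ p ∣ n
  p∤n p∣n = ¬prime[1] (subst Prime (∣1⇒≡1 (subst (p ∣_) gcd≡1 (gcd-greatest p∣n ∣-refl))) p-prime)

  a = proj₁ (Ω-positive 2≤n)
  Ωn≡ = proj₂ (Ω-positive 2≤n)

  part₁ : SquareFree n → ∀ d → ExponentialDivisor d (n * p ^ α) → H (n * p ^ α) ≤ℝ H d
  part₁ sf d d∣m =
    let y , 1≤y , y≤α , d≡ = exponentialDivisor-squareFree n p p-prime p∤n sf α d∣m
    in subst (λ z → H (n * p ^ α) ≤ℝ H z) (sym d≡)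
         (entropy-decreasing n p a p-prime p∤n Ωn≡ sf α y {{α≢0}} {{>-nonZero 1≤y}} y≤α)

  part₂ : ¬ SquareFree n → ∀ d β → ExponentialDivisor d (n * p ^ α) → d ≡ n * p ^ β →
    β ≤ α → fromℚ (ι α) ≤ℝ ι (Ω n) · exp (-ℝ H n) → H d ≤ℝ H (n * p ^ α)
  part₂ _ d β d∣m d≡ β≤α α≤Ωe^-H = subst (λ z → H z ≤ℝ H (n * p ^ α)) (sym d≡)
    (entropy-increasing n p a p-prime p∤n Ωn≡ β α
      {{exponentialDivisor-exponent n p p-prime p∤n α β d∣m d≡}} {{α≢0}} β≤α α≤Ωe^-H)
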